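{- Let $G(n)$ denote the number of graceful $n$-permutations. Then $G(n)=\Omega(2.37^n)$ as $n\to\infty$; that is, there exist a real constant $c>0$ and an integer $n_0$ such that $G(n)\ge c\cdot 2.37^n$ for all integers $n\ge n_0$.
   Context: A permutation $[\sigma(0),\ldots,\sigma(n-1)]$ of the set $\{0,1,\ldots,n-1\}$ is called a graceful $n$-permutation if $$\{|\sigma(1)-\sigma(0)|,|\sigma(2)-\sigma(1)|,\ldots,|\sigma(n-1)-\sigma(n-2)|\}=\{1,\ldots,n-1\}.$$ A permutation and its reversal are counted as two permutations (when they differ). -}

module Defs where

import Algebra.Definitions.RawSemiring as RawSemiringDefs
open import Data.Fin.Base using (Fin; toℕ)
open import Data.Fin.Properties using (_≟_; any?; all?)
open import Data.List.Base as List using (List; []; _∷_)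
open import Data.List.Membership.Propositional using (_∈_)
open import Data.List.Membership.Propositional.Properties
  using (∈-allFin; ∈-cartesianProductWith⁺; ∈-filter⁺; ∈-filter⁻)
open import Data.List.Relation.Binary.BagAndSetEquality using (_∼[_]_; set)
open import Data.List.Relation.Unary.All using ([])
open import Data.List.Relation.Unary.AllPairs using ([]; _∷_)
open import Data.List.Relation.Unary.Any using (here)
open import Data.List.Relation.Unary.Unique.Propositional using (Unique)
import Data.List.Relation.Unary.Unique.Propositional.Properties as Unique
open import Data.Nat.Base using (ℕ; zero; suc; _∸_; ∣_-_∣)
import Data.Nat.Properties as ℕ
open import Data.List.Relation.Binary.Subset.DecPropositional ℕ._≟_ using (_⊆_; _⊆?_)
open import Data.Product.Base using (_×_; _,_; proj₁; proj₂)
open import Data.Rational.Base using (+-*-rawSemiring)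
open import Data.Vec.Base as Vec using (Vec; []; _∷_; lookup)
open import Data.Vec.Properties using (∷-injective)
open import Function.Bundles using (_⇔_; mk⇔; Equivalence)
open import Function.Consequences.Propositional
  using (strictlySurjective⇒surjective; surjective⇒strictlySurjective)
open import Function.Definitions using (Injective; Surjective; Bijective)
open import Relation.Binary.PropositionalEquality using (_≡_; refl)
open import Relation.Nullary.Decidable using (Dec; map′; _×-dec_; _→-dec_)

open RawSemiringDefs +-*-rawSemiring public using () renaming (_^_ to _^ℚ_)

-- The word [σ(0), …, σ(n-1)] of a self-map of {0, …, n-1}.
Word : ℕ → Set
Word n = Vec (Fin n) n

IsPermutation : ∀ {n} → Word n → Set
IsPermutation σ = Bijective _≡_ _≡_ (lookup σ)

values : ∀ {n} → Word n → List ℕ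
values σ = List.map toℕ (Vec.toList σ)

-- zipWith truncates, so this is [|x₁ - x₀|, |x₂ - x₁|, …].
consecutiveDifferences : List ℕ → List ℕ
consecutiveDifferences xs = List.zipWith ∣_-_∣ (List.drop 1 xs) xs

-- [1, …, n-1]; empty for n ≤ 1.
oneToPred : ℕ → List ℕ
oneToPred n = List.applyUpTo suc (n ∸ 1)

IsGraceful : ∀ {n} → Word n → Set
IsGraceful {n} σ = consecutiveDifferences (values σ) ∼[ set ] oneToPred n

IsGracefulPermutation : ∀ {n} → Word n → Set
IsGracefulPermutation σ = IsPermutation σ × IsGraceful σ

isPermutation? : ∀ {n} (σ : Word n) → Dec (IsPermutation σ)
isPermutation? σ = injective? ×-dec surjective?
  where
  injective? : Dec (Injective _≡_ _≡_ (lookup σ))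
  injective? = map′ (λ inj {i} {j} → inj i j) (λ inj i j → inj {i} {j})
    (all? λ i → all? λ j → (lookup σ i ≟ lookup σ j) →-dec (i ≟ j))

  surjective? : Dec (Surjective _≡_ _≡_ (lookup σ))
  surjective? = map′ strictlySurjective⇒surjective surjective⇒strictlySurjective
    (all? λ j → any? λ i → lookup σ i ≟ j)

isGraceful? : ∀ {n} (σ : Word n) → Dec (IsGraceful σ)
isGraceful? {n} σ = map′ to from ((ds ⊆? oneToPred n) ×-dec (oneToPred n ⊆? ds))
  where
  ds : List ℕ
  ds = consecutiveDifferences (values σ)

  to : ds ⊆ oneToPred n × oneToPred n ⊆ ds → IsGraceful σ
  to (ds⊆ , ⊆ds) = mk⇔ ds⊆ ⊆ds

  from : IsGraceful σ → ds ⊆ oneToPred n × oneToPred n ⊆ ds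
  from ds≡ = (λ d∈ → Equivalence.to ds≡ d∈) , (λ d∈ → Equivalence.from ds≡ d∈)

isGracefulPermutation? : ∀ {n} (σ : Word n) → Dec (IsGracefulPermutation σ)
isGracefulPermutation? σ = isPermutation? σ ×-dec isGraceful? σ

allVecs : ∀ n k → List (Vec (Fin n) k)
allVecs n zero    = [] ∷ []
allVecs n (suc k) = List.cartesianProductWith _∷_ (List.allFin n) (allVecs n k)

gracefulPermutations : ∀ n → List (Word n)
gracefulPermutations n = List.filter isGracefulPermutation? (allVecs n n)

G : ℕ → ℕ
G n = List.length (gracefulPermutations n)

-- G counts every graceful permutation exactly once: the enumeration has no
-- repetitions and its members are precisely the graceful permutations.

allVecs-unique : ∀ n k → Unique (allVecs n k)
allVecs-unique n zero    = [] ∷ []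
allVecs-unique n (suc k) = Unique.cartesianProductWith⁺ _∷_ ∷-injective
  (Unique.allFin⁺ n) (allVecs-unique n k)

∈-allVecs : ∀ {n k} (v : Vec (Fin n) k) → v ∈ allVecs n k
∈-allVecs []      = here refl
∈-allVecs (x ∷ v) = ∈-cartesianProductWith⁺ _∷_ (∈-allFin x) (∈-allVecs v)

gracefulPermutations-unique : ∀ n → Unique (gracefulPermutations n)
gracefulPermutations-unique n =
  Unique.filter⁺ isGracefulPermutation? (allVecs-unique n n)

∈-gracefulPermutations : ∀ {n} (σ : Word n) →
  σ ∈ gracefulPermutations n ⇔ IsGracefulPermutation σ
∈-gracefulPermutations {n} σ = mk⇔
  (λ σ∈ → proj₂ (∈-filter⁻ isGracefulPermutation? {xs = allVecs n n} σ∈))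
  (∈-filter⁺ isGracefulPermutation? (∈-allVecs σ))

{-# OPTIONS --safe #-}

-- A graceful permutation is built by inserting its edges in the order of decreasing difference
-- n-1, …, 1, each edge joining ends of two of the segments formed so far (at first, single labels).
-- While only labels near 0 and near n-1 are affected, a configuration is described by a window of
-- low labels ("rows", counted upwards) and high labels ("columns", counted downwards): the labels in
-- row i and column j differ by d exactly when i + j takes a certain value, the level.  After the path
-- 6, n-7, 5, n-6, …, 0, n-1 the windows that matter are, up to translation and exchange of the two
-- sides, the 1177 vertices of a finite graph, and different walks in it insert different edges, hence
-- lead to different permutations.  Let w count the walks of length 32 back to the start.  With A the
-- adjacency operator, evaluation shows 100 · A w ≥ 237 · w, so the number of completions of a
-- configuration grows at least by the factor 2.37 with each further edge.

module Submission where

open import Defs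

-- Segments of a partial configuration, joining them, and families of completions.

module Segments where
  open import Data.Bool.Base using (if_then_else_; _∨_)
  open import Data.Empty using (⊥)
  open import Data.Fin.Base using (Fin; zero; suc; toℕ; fromℕ<)
  import Data.Fin.Properties as Fin
  open import Data.List.Base as List using (List; []; _∷_; _++_; _∷ʳ_; concat; length; map; reverse; upTo)
  import Data.List.Properties as List
  open import Data.List.Membership.Propositional using (_∈_)
  open import Data.List.Membership.Propositional.Properties using (∈-∃++; ∈-++⁺ʳ; ∈-upTo⁺; ∈-upTo⁻)
  open import Data.List.Relation.Binary.Permutation.Propositional as Perm
    using (_↭_; prep; swap; ↭-refl; ↭-sym; ↭-trans; ↭-reflexive; ↭⇒↭ₛ; module PermutationReasoning)
  import Data.List.Relation.Binary.Permutation.Propositional.Properties as Perm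
  import Data.List.Relation.Binary.Permutation.Setoid.Properties as PermSetoid
  open import Data.List.Relation.Unary.All as All using (All; []; _∷_)
  import Data.List.Relation.Unary.All.Properties as All
  open import Data.List.Relation.Unary.AllPairs using ([]; _∷_)
  open import Data.List.Relation.Unary.Any using (here; there)
  open import Data.List.Relation.Unary.Unique.Propositional using (Unique)
  import Data.List.Relation.Unary.Unique.Propositional.Properties as Unique
  open import Data.Maybe.Base using (Maybe; just; nothing)
  open import Data.Nat.Base
  open import Data.Nat.ListAction using (sum)
  import Data.Nat.Properties as ℕ
  open import Data.Product.Base using (∃; ∃₂; _×_; _,_; proj₁)
  open import Data.Sum.Base using (_⊎_; inj₁; inj₂)
  open import Data.Vec.Base as Vec using (Vec; []; _∷_)
  open import Function.Base using (_∘_; id; case_of_)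
  open import Function.Bundles using (mk⇔; Equivalence)
  open import Function.Consequences.Propositional using (strictlySurjective⇒surjective)
  open import Relation.Binary.Definitions using (DecidableEquality)
  open import Relation.Binary.PropositionalEquality as ≡
    using (_≡_; _≢_; refl; sym; trans; cong; cong₂; subst)
  open import Relation.Nullary.Decidable using (yes; no; does)
  open import Relation.Nullary.Negation using (contradiction)

  private variable
    X : Set

  concat-↭ : {xss yss : List (List X)} → xss ↭ yss → concat xss ↭ concat yss
  concat-↭ Perm.refl          = ↭-refl
  concat-↭ (prep xs p)        = Perm.++⁺ˡ xs (concat-↭ p)
  concat-↭ (swap xs ys p)     = ↭-trans (Perm.shifts xs ys) (Perm.++⁺ˡ ys (Perm.++⁺ˡ xs (concat-↭ p)))
  concat-↭ (Perm.trans p q)   = ↭-trans (concat-↭ p) (concat-↭ q)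

  unique-resp-↭ : {xs ys : List X} → xs ↭ ys → Unique xs → Unique ys
  unique-resp-↭ p = PermSetoid.Unique-resp-↭ (≡.setoid _) (↭⇒↭ₛ p)

  ∈⇒↭ : {x : X} {xs : List X} → x ∈ xs → ∃ λ ys → xs ↭ x ∷ ys
  ∈⇒↭ {x = x} x∈ with ys , zs , refl ← ∈-∃++ x∈ = ys ++ zs , Perm.shift x ys zs

  unique-⊆⇒length≤ : {xs ys : List X} → Unique xs → (∀ {x} → x ∈ xs → x ∈ ys) → length xs ≤ length ys
  unique-⊆⇒length≤ {xs = []}     _          _   = z≤n
  unique-⊆⇒length≤ {xs = x ∷ xs} (x∉ ∷ xs!) xs⊆ with zs , p ← ∈⇒↭ (xs⊆ (here refl)) =
    subst (suc (length xs) ≤_) (sym (Perm.↭-length p))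
      (s≤s (unique-⊆⇒length≤ xs! λ y∈ → rest y∈ (Perm.∈-resp-↭ p (xs⊆ (there y∈)))))
    where
    rest : ∀ {y} → y ∈ xs → y ∈ x ∷ zs → y ∈ zs
    rest y∈ (here refl) = contradiction refl (All.lookup x∉ y∈)
    rest y∈ (there y∈′) = y∈′

  infix 4 _⊑_ _⊑±_ _∈±_

  _⊑_ : List X → List X → Set
  s ⊑ p = ∃₂ λ us vs → p ≡ us ++ s ++ vs

  ⊑-refl : {s : List X} → s ⊑ s
  ⊑-refl {s = s} = [] , [] , sym (List.++-identityʳ s)

  ⊑-trans : {s t p : List X} → s ⊑ t → t ⊑ p → s ⊑ p
  ⊑-trans {s = s} (us , vs , refl) (us′ , vs′ , refl) = us′ ++ us , vs ++ vs′ , (begin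
    us′ ++ (us ++ s ++ vs) ++ vs′   ≡⟨ cong (us′ ++_) (List.++-assoc us (s ++ vs) vs′) ⟩
    us′ ++ us ++ (s ++ vs) ++ vs′   ≡⟨ cong (λ z → us′ ++ us ++ z) (List.++-assoc s vs vs′) ⟩
    us′ ++ us ++ s ++ vs ++ vs′     ≡⟨ List.++-assoc us′ us _ ⟨
    (us′ ++ us) ++ s ++ vs ++ vs′   ∎)
    where open ≡.≡-Reasoning

  ⊑-reverse : {s p : List X} → s ⊑ p → reverse s ⊑ reverse p
  ⊑-reverse {s = s} (us , vs , refl) = reverse vs , reverse us , (begin
    reverse (us ++ s ++ vs)                     ≡⟨ List.reverse-++ us (s ++ vs) ⟩
    reverse (s ++ vs) ++ reverse us             ≡⟨ cong (_++ reverse us) (List.reverse-++ s vs) ⟩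
    (reverse vs ++ reverse s) ++ reverse us     ≡⟨ List.++-assoc (reverse vs) (reverse s) (reverse us) ⟩
    reverse vs ++ reverse s ++ reverse us       ∎)
    where open ≡.≡-Reasoning

  -- A join reverses one of its two segments, so a segment may sit in the finished permutation in
  -- either direction.
  _⊑±_ : List X → List X → Set
  s ⊑± p = s ⊑ p ⊎ reverse s ⊑ p

  ⊑±-trans : {s t p : List X} → s ⊑± t → t ⊑± p → s ⊑± p
  ⊑±-trans (inj₁ a) (inj₁ b) = inj₁ (⊑-trans a b)
  ⊑±-trans (inj₁ a) (inj₂ b) = inj₂ (⊑-trans (⊑-reverse a) b)
  ⊑±-trans (inj₂ a) (inj₁ b) = inj₂ (⊑-trans a b)
  ⊑±-trans {s = s} (inj₂ a) (inj₂ b) =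
    inj₁ (⊑-trans (subst (_⊑ _) (List.reverse-involutive s) (⊑-reverse a)) b)

  _∈±_ : List X → List (List X) → Set
  s ∈± S = s ∈ S ⊎ reverse s ∈ S

  Ends : List X → X → X → Set
  Ends s x y = (∃ λ t → s ≡ x ∷ t) × (∃ λ t → s ≡ t ∷ʳ y)

  ends-reverse : {s : List X} {x y : X} → Ends s x y → Ends (reverse s) y x
  ends-reverse {x = x} {y} ((t , s≡) , (u , s≡′)) =
      (reverse u , trans (cong reverse s≡′) (List.reverse-++ u (y ∷ [])))
    , (reverse t , trans (cong reverse s≡) (List.unfold-reverse x t))

  ends-unique : {s : List X} {x y x′ y′ : X} → Ends s x y → Ends s x′ y′ → x ≡ x′ × y ≡ y′
  ends-unique ((_ , refl) , (u , e)) ((_ , e′) , (u′ , e″)) =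
    List.∷-injectiveˡ e′ , List.∷ʳ-injectiveʳ u u′ (trans (sym e) e″)

  ends-++ : {s t : List X} {x y z w : X} → Ends s x y → Ends t z w → Ends (s ++ t) x w
  ends-++ {s = s} {t} {x} {w = w} ((s₁ , s≡) , _) (_ , (t₁ , t≡)) =
    (s₁ ++ t , cong (_++ t) s≡) , (s ++ t₁ , trans (cong (s ++_) t≡) (sym (List.++-assoc s t₁ (w ∷ []))))

  Segment : List (List X) → X → X → Set
  Segment S x y = ∃ λ s → s ∈± S × Ends s x y

  segment-sym : {S : List (List X)} {x y : X} → Segment S x y → Segment S y x
  segment-sym {S = S} (s , s∈ , e) = reverse s , flip s∈ , ends-reverse e
    where
    flip : s ∈± S → reverse s ∈± S
    flip (inj₁ s∈) = inj₂ (subst (_∈ S) (sym (List.reverse-involutive s)) s∈)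
    flip (inj₂ s∈) = inj₁ s∈

  -- Differences along joined lists, and edges determined by their difference.

  differences : List ℕ → List ℕ
  differences = consecutiveDifferences

  differences-++ : ∀ xs {x y} ys →
    differences (xs ++ x ∷ y ∷ ys) ≡ differences (xs ∷ʳ x) ++ ∣ y - x ∣ ∷ differences (y ∷ ys)
  differences-++ []            ys = refl
  differences-++ (z ∷ [])      ys = refl
  differences-++ (z ∷ w ∷ xs)  ys = cong (∣ w - z ∣ ∷_) (differences-++ (w ∷ xs) ys)

  differences-reverse : ∀ xs → differences (reverse xs) ↭ differences xs
  differences-reverse []           = ↭-refl
  differences-reverse (x ∷ [])     = ↭-refl
  differences-reverse (x ∷ y ∷ ys) = begin
    differences (reverse (x ∷ y ∷ ys))                      ≡⟨ cong differences (List.unfold-reverse x (y ∷ ys)) ⟩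
    differences (reverse (y ∷ ys) ∷ʳ x)                     ≡⟨ cong (λ zs → differences (zs ∷ʳ x)) (List.unfold-reverse y ys) ⟩
    differences ((reverse ys ∷ʳ y) ∷ʳ x)                    ≡⟨ cong differences (List.++-assoc (reverse ys) _ _) ⟩
    differences (reverse ys ++ y ∷ x ∷ [])                  ≡⟨ differences-++ (reverse ys) [] ⟩
    differences (reverse ys ∷ʳ y) ∷ʳ ∣ x - y ∣              ↭⟨ Perm.∷↭∷ʳ _ _ ⟨
    ∣ x - y ∣ ∷ differences (reverse ys ∷ʳ y)               ≡⟨ cong₂ (λ d zs → d ∷ differences zs) (ℕ.∣-∣-comm x y)
                                                                (sym (List.unfold-reverse y ys)) ⟩
    ∣ y - x ∣ ∷ differences (reverse (y ∷ ys))              ↭⟨ prep _ (differences-reverse (y ∷ ys)) ⟩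
    ∣ y - x ∣ ∷ differences (y ∷ ys)                        ∎
    where open PermutationReasoning

  -- Reversing `s` brings its end `x` next to `y`, which creates one new difference; those inside
  -- the two lists survive up to order.
  differences-join : ∀ {s t x p y q} → Ends s x p → Ends t y q →
    differences (reverse s ++ t) ↭ ∣ x - y ∣ ∷ differences s ++ differences t
  differences-join {t = t} {x} {y = y} ((s₁ , refl) , _) ((t₁ , refl) , _) = begin
    differences (reverse (x ∷ s₁) ++ y ∷ t₁)                           ≡⟨ cong (λ zs → differences (zs ++ t)) (List.unfold-reverse x s₁) ⟩
    differences ((reverse s₁ ∷ʳ x) ++ y ∷ t₁)                          ≡⟨ cong differences (List.++-assoc (reverse s₁) _ _) ⟩
    differences (reverse s₁ ++ x ∷ y ∷ t₁)                             ≡⟨ differences-++ (reverse s₁) t₁ ⟩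
    differences (reverse s₁ ∷ʳ x) ++ ∣ y - x ∣ ∷ differences (y ∷ t₁)
      ↭⟨ Perm.shift ∣ y - x ∣ (differences (reverse s₁ ∷ʳ x)) (differences t) ⟩
    ∣ y - x ∣ ∷ differences (reverse s₁ ∷ʳ x) ++ differences t
      ≡⟨ cong₂ (λ d zs → d ∷ differences zs ++ differences t) (ℕ.∣-∣-comm y x) (sym (List.unfold-reverse x s₁)) ⟩
    ∣ x - y ∣ ∷ differences (reverse (x ∷ s₁)) ++ differences t        ↭⟨ prep _ (Perm.++⁺ʳ (differences t) (differences-reverse (x ∷ s₁))) ⟩
    ∣ x - y ∣ ∷ differences (x ∷ s₁) ++ differences t                  ∎
    where open PermutationReasoning

  Adjacent : List ℕ → ℕ → ℕ → Set
  Adjacent p x y = (x ∷ y ∷ []) ⊑± p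

  join-adjacent : ∀ {s t x p y q} → Ends s x p → Ends t y q → Adjacent (reverse s ++ t) x y
  join-adjacent {x = x} {y = y} ((s₁ , refl) , _) ((t₁ , refl) , _) = inj₁ (reverse s₁ , t₁ , (begin
    reverse (x ∷ s₁) ++ y ∷ t₁       ≡⟨ cong (_++ y ∷ t₁) (List.unfold-reverse x s₁) ⟩
    (reverse s₁ ∷ʳ x) ++ y ∷ t₁      ≡⟨ List.++-assoc (reverse s₁) _ _ ⟩
    reverse s₁ ++ x ∷ y ∷ t₁         ∎))
    where open ≡.≡-Reasoning

  SameEdge : ℕ → ℕ → ℕ → ℕ → Set
  SameEdge x y x′ y′ = (x ≡ x′ × y ≡ y′) ⊎ (x ≡ y′ × y ≡ x′)

  -- A difference that occurs only once in `p` occurs at only one position, and the position fixes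
  -- the two labels. The directions in which the two edges are read give the four cases.
  edge-determined : ∀ p {x y x′ y′} → Unique (differences p) → ∣ x - y ∣ ≡ ∣ x′ - y′ ∣ →
    Adjacent p x y → Adjacent p x′ y′ → SameEdge x y x′ y′
  edge-determined p {x} {y} {x′} {y′} p! d≡ = λ where
      (inj₁ a) (inj₁ b) → inj₁ (ordered p! d≡ a b)
      (inj₁ a) (inj₂ b) → inj₂ (ordered p! (trans d≡ (ℕ.∣-∣-comm x′ y′)) a b)
      (inj₂ a) (inj₁ b) → case ordered p! (trans (ℕ.∣-∣-comm y x) d≡) a b of λ (e , e′) → inj₂ (e′ , e)
      (inj₂ a) (inj₂ b) → case ordered p! (trans (ℕ.∣-∣-comm y x) (trans d≡ (ℕ.∣-∣-comm x′ y′))) a b of λ (e , e′) → inj₁ (e′ , e)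
    where
    occurs : ∀ us {a b} vs → ∣ a - b ∣ ∈ differences (us ++ a ∷ b ∷ vs)
    occurs us {a} {b} vs = subst (∣ a - b ∣ ∈_) (sym (differences-++ us vs))
      (∈-++⁺ʳ (differences (us ∷ʳ a)) (here (ℕ.∣-∣-comm a b)))

    -- Induction on the positions of the two edges. If just one of them starts at the head, its
    -- difference recurs in the tail, against uniqueness.
    ordered : ∀ {p x y x′ y′} → Unique (differences p) → ∣ x - y ∣ ≡ ∣ x′ - y′ ∣ →
      (x ∷ y ∷ []) ⊑ p → (x′ ∷ y′ ∷ []) ⊑ p → x ≡ x′ × y ≡ y′
    ordered _ _ ([] , _ , refl) ([] , _ , refl) = refl , refl
    ordered {x = x} {y} (d∉ ∷ _) d≡ ([] , vs , refl) (_ ∷ [] , vs′ , refl) =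
      contradiction (trans (ℕ.∣-∣-comm y x) d≡) (All.lookup d∉ (occurs [] vs′))
    ordered {x = x} {y} (d∉ ∷ _) d≡ ([] , vs , refl) (_ ∷ _ ∷ us′ , vs′ , refl) =
      contradiction (trans (ℕ.∣-∣-comm y x) d≡) (All.lookup d∉ (occurs (_ ∷ us′) vs′))
    ordered {x′ = x′} {y′} (d∉ ∷ _) d≡ (_ ∷ [] , vs , refl) ([] , vs′ , refl) =
      contradiction (trans (ℕ.∣-∣-comm y′ x′) (sym d≡)) (All.lookup d∉ (occurs [] vs))
    ordered {x′ = x′} {y′} (d∉ ∷ _) d≡ (_ ∷ _ ∷ us , vs , refl) ([] , vs′ , refl) =
      contradiction (trans (ℕ.∣-∣-comm y′ x′) (sym d≡)) (All.lookup d∉ (occurs (_ ∷ us) vs))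
    ordered {p = _ ∷ _ ∷ _} (_ ∷ p!) d≡ (_ ∷ us , vs , e) (_ ∷ us′ , vs′ , e′) =
      ordered p! d≡ (us , vs , List.∷-injectiveʳ e) (us′ , vs′ , List.∷-injectiveʳ e′)

  -- A configuration is given by the map sending each end of a segment to the other end of that segment.
  -- link adds the edge xy, where p and q are the ends opposite to x and y.
  module _ {X : Set} (_≟_ : DecidableEquality X) where
    link : (X → Maybe X) → (x y p q : X) → X → Maybe X
    link f x y p q z =
      if does (z ≟ p) then just q else
      if does (z ≟ q) then just p else
      if does (z ≟ x) ∨ does (z ≟ y) then nothing else f z

    -- The order of the tests in `link` matters: if `x` is isolated, then `p` is `x`, and `x`
    -- remains an end. Hence the first two alternatives do not exclude that `z` is `x` or `y`.
    link-cases : ∀ {f x y p q z w} → link f x y p q z ≡ just w →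
      (z ≡ p × w ≡ q) ⊎ (z ≡ q × w ≡ p) ⊎ (z ≢ p × z ≢ q × z ≢ x × z ≢ y × f z ≡ just w)
    link-cases {x = x} {y} {p} {q} {z} e with z ≟ p
    link-cases refl | yes z≡p = inj₁ (z≡p , refl)
    ... | no z≢p with z ≟ q
    link-cases refl | no z≢p | yes z≡q = inj₂ (inj₁ (z≡q , refl))
    ... | no z≢q with z ≟ x | z ≟ y
    link-cases () | no z≢p | no z≢q | yes _ | _
    link-cases () | no z≢p | no z≢q | no _ | yes _
    ... | no z≢x | no z≢y = inj₂ (inj₂ (z≢p , z≢q , z≢x , z≢y , e))

  -- The configuration S when the differences above d have been used.
  record Partial (n : ℕ) (A : ℕ → Maybe ℕ) (S : List (List ℕ)) (d : ℕ) : Set where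
    field
      vertices : concat S ↭ upTo n
      edges    : concat (map differences S) ++ oneToPred (suc d) ↭ oneToPred n
      number   : length S ≡ suc d
      segment  : ∀ {x y} → A x ≡ just y → Segment S x y

  -- The condition `p ≢ y` puts `x` and `y` on different segments, so that joining them closes no
  -- cycle. The last component turns completions of the joined configuration into completions of `S`
  -- that use the new edge.
  linked : ∀ {n A S d x y p q} → Partial n A S (suc d) →
    A x ≡ just p → A y ≡ just q → p ≢ y → ∣ x - y ∣ ≡ suc d →
    ∃ λ S′ → Partial n (link ℕ._≟_ A x y p q) S′ d
      × (∀ P → All (_⊑± P) S′ → All (_⊑± P) S × Adjacent P x y)
  linked {n} {A} {S} {d} {x} {y} {p} {q} 𝒫 Ax Ay p≢y d≡
    with s , s∈ , se ← Partial.segment 𝒫 Ax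
    with t , t∈ , te ← Partial.segment 𝒫 Ay
    = result s∈ t∈
    where
    open Partial 𝒫
    x≢y : x ≢ y
    x≢y refl = case trans (sym (ℕ.∣n-n∣≡0 x)) d≡ of λ ()

    -- s₀ is the member of S that s or its reversal is.
    Orientation : List ℕ → List ℕ → Set
    Orientation s₀ s = s ≡ s₀ ⊎ reverse s ≡ s₀

    orient : ∀ {s} → s ∈± S → ∃ λ s₀ → s₀ ∈ S × Orientation s₀ s
    orient (inj₁ s∈) = _ , s∈ , inj₁ refl
    orient (inj₂ s∈) = _ , s∈ , inj₂ refl

    orientation-ends : ∀ {s₀ s t a b c e} → Orientation s₀ s → Orientation s₀ t → Ends s a b → Ends t c e →
      (a ≡ c × b ≡ e) ⊎ (a ≡ e × b ≡ c)
    orientation-ends (inj₁ refl) (inj₁ refl) se te = inj₁ (ends-unique se te)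
    orientation-ends (inj₁ refl) (inj₂ refl) se te = inj₂ (ends-unique se (ends-reverse te))
    orientation-ends (inj₂ refl) (inj₁ refl) se te with e , e′ ← ends-unique (ends-reverse se) te = inj₂ (e′ , e)
    orientation-ends (inj₂ refl) (inj₂ e) se te
      with e , e′ ← ends-unique se (subst (λ z → Ends z _ _) (List.reverse-injective e) te) = inj₁ (e , e′)

    ↭-orientation : ∀ {s₀ s} → Orientation s₀ s → s ↭ s₀
    ↭-orientation (inj₁ refl) = ↭-refl
    ↭-orientation {s = s} (inj₂ refl) = ↭-sym (Perm.↭-reverse s)

    differences-orientation : ∀ {s₀ s} → Orientation s₀ s → differences s ↭ differences s₀
    differences-orientation (inj₁ refl) = ↭-refl
    differences-orientation {s = s} (inj₂ refl) = ↭-sym (differences-reverse s)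

    ⊑±-orientation : ∀ {s₀ s P} → Orientation s₀ s → s ⊑± P → s₀ ⊑± P
    ⊑±-orientation (inj₁ refl) = id
    ⊑±-orientation {s = s} (inj₂ refl) = ⊑±-trans (inj₂ (subst (_⊑ s) (sym (List.reverse-involutive s)) ⊑-refl))

    oneToPred-suc : oneToPred (suc (suc d)) ↭ suc d ∷ oneToPred (suc d)
    oneToPred-suc = ↭-trans (↭-reflexive (sym (List.applyUpTo-∷ʳ suc d))) (↭-sym (Perm.∷↭∷ʳ (suc d) _))

    module Result {s₀ t₀ U s t} (S↭ : S ↭ s₀ ∷ t₀ ∷ U) (so : Orientation s₀ s) (to : Orientation t₀ t)
      (se : Ends s x p) (te : Ends t y q) where
      new : List ℕ
      new = reverse s ++ t

      new-ends : Ends new p q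
      new-ends = ends-++ (ends-reverse se) te

      -- A segment with an end other than `x`, `y`, `p`, `q` is neither of the two that are joined,
      -- whose ends are exactly these, so it stays in `U`.
      old-segment : ∀ {z w} → z ≢ p → z ≢ q → z ≢ x → z ≢ y → Segment S z w → Segment (new ∷ U) z w
      old-segment z≢p z≢q z≢x z≢y (u , u∈ , ue) with u₀ , u₀∈ , uo ← orient u∈ with Perm.∈-resp-↭ S↭ u₀∈
      ... | here refl with orientation-ends uo so ue se
      ...   | inj₁ (z≡x , _) = contradiction z≡x z≢x
      ...   | inj₂ (z≡p , _) = contradiction z≡p z≢p
      old-segment z≢p z≢q z≢x z≢y (u , u∈ , ue) | there (here refl) with orientation-ends uo to ue te
      ...   | inj₁ (z≡y , _) = contradiction z≡y z≢y
      ...   | inj₂ (z≡q , _) = contradiction z≡q z≢q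
      old-segment z≢p z≢q z≢x z≢y (u , u∈ , ue) | there (there u₀∈U) = u , back uo , ue
        where
        back : Orientation _ u → u ∈± (new ∷ U)
        back (inj₁ refl) = inj₁ (there u₀∈U)
        back (inj₂ refl) = inj₂ (there u₀∈U)

      new-segment : ∀ {z w} → link ℕ._≟_ A x y p q z ≡ just w → Segment (new ∷ U) z w
      new-segment {z} e with link-cases ℕ._≟_ {A} {x} {y} {p} {q} {z} e
      ... | inj₁ (refl , refl)        = new , inj₁ (here refl) , new-ends
      ... | inj₂ (inj₁ (refl , refl)) = segment-sym {S = new ∷ U} (new , inj₁ (here refl) , new-ends)
      ... | inj₂ (inj₂ (z≢p , z≢q , z≢x , z≢y , Az)) = old-segment z≢p z≢q z≢x z≢y (segment Az)

      partial : Partial n (link ℕ._≟_ A x y p q) (new ∷ U) d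
      partial = record
        { vertices = begin
            (reverse s ++ t) ++ concat U
              ↭⟨ Perm.++⁺ʳ (concat U) (Perm.++⁺ (↭-trans (Perm.↭-reverse s) (↭-orientation so)) (↭-orientation to)) ⟩
            (s₀ ++ t₀) ++ concat U        ≡⟨ List.++-assoc s₀ t₀ (concat U) ⟩
            s₀ ++ t₀ ++ concat U          ↭⟨ concat-↭ S↭ ⟨
            concat S                      ↭⟨ vertices ⟩
            upTo n                        ∎
        ; edges = begin
            (differences new ++ D) ++ oneToPred (suc d)
              ↭⟨ Perm.++⁺ʳ (oneToPred (suc d)) (Perm.++⁺ʳ D (differences-join se te)) ⟩
            ∣ x - y ∣ ∷ ((differences s ++ differences t) ++ D) ++ oneToPred (suc d)
              ≡⟨ cong (_∷ ((differences s ++ differences t) ++ D) ++ oneToPred (suc d)) d≡ ⟩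
            suc d ∷ ((differences s ++ differences t) ++ D) ++ oneToPred (suc d)
              ↭⟨ Perm.shift (suc d) ((differences s ++ differences t) ++ D) (oneToPred (suc d)) ⟨
            ((differences s ++ differences t) ++ D) ++ suc d ∷ oneToPred (suc d)
              ↭⟨ Perm.++⁺ (Perm.++⁺ʳ D (Perm.++⁺ (differences-orientation so) (differences-orientation to))) (↭-sym oneToPred-suc) ⟩
            ((differences s₀ ++ differences t₀) ++ D) ++ oneToPred (suc (suc d))
              ≡⟨ cong (_++ oneToPred (suc (suc d))) (List.++-assoc (differences s₀) _ _) ⟩
            (differences s₀ ++ differences t₀ ++ D) ++ oneToPred (suc (suc d))
              ↭⟨ Perm.++⁺ʳ (oneToPred (suc (suc d))) (concat-↭ (Perm.map⁺ differences S↭)) ⟨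
            concat (map differences S) ++ oneToPred (suc (suc d))
              ↭⟨ edges ⟩
            oneToPred n ∎
        ; number  = ℕ.suc-injective (trans (sym (Perm.↭-length S↭)) number)
        ; segment = new-segment
        }
        where
        open PermutationReasoning
        D : List ℕ
        D = concat (map differences U)

      s⊑new : s ⊑± new
      s⊑new = inj₂ ([] , t , refl)

      t⊑new : t ⊑± new
      t⊑new = inj₁ (reverse s , [] , cong (reverse s ++_) (sym (List.++-identityʳ t)))

      contains : ∀ P → All (_⊑± P) (new ∷ U) → All (_⊑± P) S × Adjacent P x y
      contains P (new⊑ ∷ U⊑) =
          Perm.All-resp-↭ (↭-sym S↭) (⊑±-orientation so (⊑±-trans s⊑new new⊑) ∷ ⊑±-orientation to (⊑±-trans t⊑new new⊑) ∷ U⊑)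
        , ⊑±-trans (join-adjacent se te) new⊑

    result : s ∈± S → t ∈± S → _
    result s∈ t∈ with s₀ , s₀∈ , so ← orient s∈ | t₀ , t₀∈ , to ← orient t∈
      with U₁ , S↭ ← ∈⇒↭ s₀∈ with Perm.∈-resp-↭ S↭ t₀∈
    -- If both labels were ends of the same segment, then either `x` would be `y`, a difference of
    -- zero, or `p` would be `y`.
    ... | here refl with orientation-ends so to se te
    ...   | inj₁ (x≡y , _) = contradiction x≡y x≢y
    ...   | inj₂ (_ , p≡y) = contradiction p≡y p≢y
    result s∈ t∈ | there t₀∈U₁ with U , U₁↭ ← ∈⇒↭ t₀∈U₁ = new ∷ U , partial , contains
      where open Result (↭-trans S↭ (prep _ U₁↭)) so to se te

  -- Completions of a configuration and lower bounds for their number.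

  record Completion (n : ℕ) (S : List (List ℕ)) (P : List ℕ) : Set where
    constructor completion
    field
      vertices : P ↭ upTo n
      edges    : differences P ↭ oneToPred n
      contains : All (_⊑± P) S

  -- A lower bound rather than a cardinality: the members need not be all lists with the property.
  record Count (Q : List ℕ → Set) (c : ℕ) : Set where
    constructor count
    field
      members : List (List ℕ)
      unique  : Unique members
      sound   : All Q members
      size    : length members ≡ c

  count-map : ∀ {Q R c} → (∀ {P} → Q P → R P) → Count Q c → Count R c
  count-map f (count Ps Ps! sound size) = count Ps Ps! (All.map f sound) size

  count-0 : ∀ {Q} → Count Q 0
  count-0 = count [] [] [] refl

  -- With no difference left a single segment remains, and it is itself the completion.
  count-final : ∀ {n A S} → Partial n A S 0 → Count (Completion n S) 1
  count-final {S = []} 𝒫 = case Partial.number 𝒫 of λ ()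
  count-final {S = _ ∷ _ ∷ _} 𝒫 = case Partial.number 𝒫 of λ ()
  count-final {S = P ∷ []} 𝒫 = count (P ∷ []) ([] ∷ [])
    (completion (subst (_↭ _) (List.++-identityʳ P) vertices)
       (subst (_↭ _) (trans (List.++-identityʳ _) (List.++-identityʳ (differences P))) edges)
       (inj₁ ⊑-refl ∷ []) ∷ []) refl
    where open Partial 𝒫

  oneToPred-unique : ∀ n → Unique (oneToPred n)
  oneToPred-unique n = Unique.applyUpTo⁺₁ suc (n ∸ 1) λ i<j _ e → ℕ.<⇒≢ i<j (ℕ.suc-injective e)

  -- A completion has only one edge of difference d, so completions through different edges of that
  -- difference are different.
  count-sum : ∀ {n S d} (x y c : ℕ → ℕ) (is : List ℕ) → Unique is →
    (∀ {i} → i ∈ is → ∣ x i - y i ∣ ≡ d) →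
    (∀ {i j} → i ∈ is → j ∈ is → SameEdge (x i) (y i) (x j) (y j) → i ≡ j) →
    (∀ {i} → i ∈ is → Count (λ P → Completion n S P × Adjacent P (x i) (y i)) (c i)) →
    Count (Completion n S) (sum (map c is))
  count-sum {n} {S} x y c is is! d≡ distinct counts = count-map proj₁ (go is is! id)
    where
    Through : List ℕ → List ℕ → Set
    Through js P = Completion n S P × ∃ λ j → j ∈ js × Adjacent P (x j) (y j)

    go : ∀ js → Unique js → (∀ {j} → j ∈ js → j ∈ is) → Count (Through js) (sum (map c js))
    go []       _            _   = count-0
    go (j ∷ js) (j∉js ∷ js!) js⊆ with counts (js⊆ (here refl)) | go js js! (js⊆ ∘ there)
    ... | count Ps Ps! Ps-sound Ps-size | count Qs Qs! Qs-sound Qs-size = record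
      { members = Ps ++ Qs
      ; unique  = Unique.++⁺ Ps! Qs! λ (P∈ , P∈′) → disjoint (All.lookup Ps-sound P∈) (All.lookup Qs-sound P∈′)
      ; sound   = All.++⁺ (All.map (λ (C , adj) → C , j , here refl , adj) Ps-sound)
                          (All.map (λ (C , k , k∈ , adj) → C , k , there k∈ , adj) Qs-sound)
      ; size    = trans (List.length-++ Ps) (cong₂ _+_ Ps-size Qs-size)
      }
      where
      disjoint : ∀ {P} → Completion n S P × Adjacent P (x j) (y j) → Through js P → ⊥
      disjoint {P} (C , adj) (_ , k , k∈ , adj′) = All.lookup j∉js k∈ (distinct (js⊆ (here refl)) (js⊆ (there k∈))
        (edge-determined P (unique-resp-↭ (↭-sym (Completion.edges C)) (oneToPred-unique n))
          (trans (d≡ (js⊆ (here refl))) (sym (d≡ (js⊆ (there k∈))))) adj adj′))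

  -- From lists to the words counted by `G`.

  toWord : ∀ {n m} (P : List ℕ) → All (_< n) P → length P ≡ m →
    ∃ λ (v : Vec (Fin n) m) → map toℕ (Vec.toList v) ≡ P
  toWord []      []         refl = [] , refl
  toWord (x ∷ P) (x<n ∷ P<) refl with v , v≡ ← toWord P P< refl = fromℕ< x<n ∷ v , cong₂ _∷_ (Fin.toℕ-fromℕ< x<n) v≡

  ∈⇒lookup : ∀ {n m} (v : Vec (Fin n) m) {x} → x ∈ map toℕ (Vec.toList v) → ∃ λ i → toℕ (Vec.lookup v i) ≡ x
  ∈⇒lookup (_ ∷ _) (here refl) = zero , refl
  ∈⇒lookup (_ ∷ v) (there x∈) with i , e ← ∈⇒lookup v x∈ = suc i , e

  lookup⇒∈ : ∀ {n m} (v : Vec (Fin n) m) i → toℕ (Vec.lookup v i) ∈ map toℕ (Vec.toList v)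
  lookup⇒∈ (_ ∷ _) zero    = here refl
  lookup⇒∈ (_ ∷ v) (suc i) = there (lookup⇒∈ v i)

  unique⇒lookup-injective : ∀ {n m} (v : Vec (Fin n) m) → Unique (map toℕ (Vec.toList v)) →
    ∀ {i j} → Vec.lookup v i ≡ Vec.lookup v j → i ≡ j
  unique⇒lookup-injective (_ ∷ _) _         {zero}  {zero}  _ = refl
  unique⇒lookup-injective (_ ∷ v) (x∉ ∷ _)  {zero}  {suc j} e = contradiction (cong toℕ e) (All.lookup x∉ (lookup⇒∈ v j))
  unique⇒lookup-injective (_ ∷ v) (x∉ ∷ _)  {suc i} {zero}  e = contradiction (cong toℕ (sym e)) (All.lookup x∉ (lookup⇒∈ v i))
  unique⇒lookup-injective (_ ∷ v) (_ ∷ v!)  {suc i} {suc j} e = cong suc (unique⇒lookup-injective v v! e)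

  isGracefulPermutation : ∀ {n} (v : Word n) → values v ↭ upTo n → differences (values v) ↭ oneToPred n →
    IsGracefulPermutation v
  isGracefulPermutation {n} v v↭ ds↭ = (injective , strictlySurjective⇒surjective surjective) ,
    mk⇔ (Perm.∈-resp-↭ ds↭) (Perm.∈-resp-↭ (↭-sym ds↭))
    where
    injective : ∀ {i j} → Vec.lookup v i ≡ Vec.lookup v j → i ≡ j
    injective = unique⇒lookup-injective v (unique-resp-↭ (↭-sym v↭) (Unique.upTo⁺ n))

    surjective : ∀ k → ∃ λ i → Vec.lookup v i ≡ k
    surjective k with i , e ← ∈⇒lookup v (Perm.∈-resp-↭ (↭-sym v↭) (∈-upTo⁺ (Fin.toℕ<n k))) = i , Fin.toℕ-injective e

  completion-words : ∀ {n S} Ps → All (Completion n S) Ps →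
    ∃ λ (Ws : List (Word n)) → map values Ws ≡ Ps × All IsGracefulPermutation Ws
  completion-words []       []       = [] , refl , []
  completion-words {n} (P ∷ Ps) (completion P↭ ds↭ _ ∷ Cs)
    with Ws , Ws≡ , Ws-graceful ← completion-words Ps Cs
    with v , refl ← toWord P (Perm.All-resp-↭ (↭-sym P↭) (All.tabulate ∈-upTo⁻))
                      (trans (Perm.↭-length P↭) (List.length-upTo n))
    = v ∷ Ws , cong (P ∷_) Ws≡ , isGracefulPermutation v P↭ ds↭ ∷ Ws-graceful

  -- Completions are the value lists of graceful words. Since the lists are distinct, so are the
  -- words, and all of them occur in the enumeration behind `G`.
  count⇒≤G : ∀ {n S c} → Count (Completion n S) c → c ≤ G n
  count⇒≤G {n} {S} (count Ps Ps! sound refl) with Ws , Ws≡ , Ws-graceful ← completion-words Ps sound =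
    subst (_≤ G n) (trans (sym (List.length-map values Ws)) (cong length Ws≡))
      (unique-⊆⇒length≤ (Unique.map⁻ (subst Unique (sym Ws≡) Ps!))
        λ {σ} σ∈ → Equivalence.from (∈-gracefulPermutations σ) (All.lookup Ws-graceful σ∈))

open Segments

-- Windows of low and high labels, and moves between them.

module Windows where
  open import Data.Bool.Base using (Bool; true; false)
  open import Data.Empty using (⊥)
  open import Data.List.Base using (List; []; _∷_; _++_; length; map; upTo)
  open import Data.List.Membership.Propositional using (_∈_)
  open import Data.List.Membership.Propositional.Properties using (∈-upTo⁺; ∈-++⁺ˡ; ∈-++⁺ʳ; ∈-map⁺)
  open import Data.List.Relation.Unary.All as All using (All; []; _∷_; all?)
  open import Data.Maybe.Base as Maybe using (Maybe; just; nothing)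
  import Data.Maybe.Properties as Maybe
  open import Data.Nat.Base
  import Data.Nat.Properties as ℕ
  open import Data.Nat.Tactic.RingSolver using (solve-∀)
  open import Data.Product.Base using (_×_; _,_)
  open import Data.Sum.Base using (_⊎_; inj₁; inj₂)
  open import Data.Unit.Base using (⊤; tt)
  open import Function.Base using (_∘_; case_of_)
  open import Function.Bundles using (mk⇔)
  open import Relation.Binary.Definitions using (DecidableEquality)
  open import Relation.Binary.PropositionalEquality
    using (_≡_; _≢_; refl; sym; trans; cong; cong₂; subst; subst₂)
  open import Relation.Nullary.Decidable using (Dec; yes; no; does; map′; _×-dec_; ¬?; does-⇔)
  open import Relation.Nullary.Negation using (¬_; contradiction)

  -- The tip is the end of the path that stays fixed; it lies outside the window.
  data Vertex : Set where
    row col : ℕ → Vertex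
    tip     : Vertex

  _≟ᵛ_ : DecidableEquality Vertex
  row i ≟ᵛ row j = map′ (cong row) (λ { refl → refl }) (i ℕ.≟ j)
  row i ≟ᵛ col j = no λ ()
  row i ≟ᵛ tip   = no λ ()
  col i ≟ᵛ row j = no λ ()
  col i ≟ᵛ col j = map′ (cong col) (λ { refl → refl }) (i ℕ.≟ j)
  col i ≟ᵛ tip   = no λ ()
  tip   ≟ᵛ row j = no λ ()
  tip   ≟ᵛ col j = no λ ()
  tip   ≟ᵛ tip   = yes refl

  -- An entry is the other end of the segment ending at the vertex, or nothing for an inner vertex of a
  -- segment.  Vertices beyond the lists are isolated, hence their own other ends.
  record State : Set where
    constructor state
    field
      level     : ℕ
      rows cols : List (Maybe Vertex)

    height width : ℕ
    height = length rows
    width  = length cols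

  open State

  entry : Maybe Vertex → List (Maybe Vertex) → ℕ → Maybe Vertex
  entry v []       _       = v
  entry v (x ∷ xs) zero    = x
  entry v (x ∷ xs) (suc i) = entry v xs i

  entry-outside : ∀ v xs {i} → length xs ≤ i → entry v xs i ≡ v
  entry-outside v []       _         = refl
  entry-outside v (x ∷ xs) (s≤s l≤i) = entry-outside v xs l≤i

  status : State → Vertex → Maybe Vertex
  status s (row i) = entry (just (row i)) (rows s) i
  status s (col j) = entry (just (col j)) (cols s) j
  status s tip     = nothing

  InWindow : ℕ → ℕ → Vertex → Set
  InWindow r c (row i) = i < r
  InWindow r c (col j) = j < c
  InWindow r c tip     = ⊤

  inWindow? : ∀ r c v → Dec (InWindow r c v)
  inWindow? r c (row i) = i ℕ.<? r
  inWindow? r c (col j) = j ℕ.<? c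
  inWindow? r c tip     = yes tt

  -- A label between the two windows has a name as a row and another one as a column.
  InDomain : ℕ → ℕ → ℕ → Vertex → Set
  InDomain r c M (row i) = i + c < M
  InDomain r c M (col j) = j + r < M
  InDomain r c M tip     = ⊥

  -- ℓ names the labels of an interval of length M, counting rows from one end and columns from the other.
  record Frame (ℓ : Vertex → ℕ) (M : ℕ) : Set where
    field
      row-injective : ∀ {i j} → i < M → j < M → ℓ (row i) ≡ ℓ (row j) → i ≡ j
      col-injective : ∀ {i j} → i < M → j < M → ℓ (col i) ≡ ℓ (col j) → i ≡ j
      tip≢row       : ∀ {i} → i < M → ℓ tip ≢ ℓ (row i)
      tip≢col       : ∀ {i} → i < M → ℓ tip ≢ ℓ (col i)
      distance      : ∀ {i j t} → suc (i + j + t) ≡ M → ∣ ℓ (row i) - ℓ (col j) ∣ ≡ t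

    row≢col : ∀ {i j} → suc (i + j) < M → ℓ (row i) ≢ ℓ (col j)
    row≢col {i} {j} lt e with o , o≡ ← ℕ.m≤n⇒∃[o]m+o≡n lt =
      case trans (sym (distance {t = suc o} (trans (cong suc (ℕ.+-suc (i + j) o)) o≡)))
             (trans (cong (λ z → ∣ z - ℓ (col j) ∣) e) (ℕ.∣n-n∣≡0 (ℓ (col j)))) of λ ()

    -- The domain condition keeps `v` out of the opposite window under its second name, so a window
    -- vertex with the same label is counted from the same side; the tip has a label outside the
    -- interval.
    separated : ∀ {r c v w} → r + c ≤ M → InDomain r c M v → InWindow r c w → ℓ v ≡ ℓ w → v ≡ w
    separated {r} {c} {row i} {row j} fits i<  j< e =
      cong row (row-injective (ℕ.≤-<-trans (ℕ.m≤m+n i c) i<) (ℕ.<-≤-trans j< (ℕ.≤-trans (ℕ.m≤m+n r c) fits)) e)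
    separated {r} {c} {row i} {col j} fits i<  j< e =
      contradiction e (row≢col (ℕ.≤-<-trans (subst (_≤ i + c) (ℕ.+-suc i j) (ℕ.+-monoʳ-≤ i j<)) i<))
    separated {r} {c} {row i} {tip}   fits i<  _  e =
      contradiction (sym e) (tip≢row (ℕ.≤-<-trans (ℕ.m≤m+n i c) i<))
    separated {r} {c} {col j} {row i} fits j<  i< e =
      contradiction (sym e) (row≢col (ℕ.≤-<-trans (subst (λ z → suc z ≤ j + r) (ℕ.+-comm j i)
        (subst (_≤ j + r) (ℕ.+-suc j i) (ℕ.+-monoʳ-≤ j i<))) j<))
    separated {r} {c} {col j} {col k} fits j<  k< e =
      cong col (col-injective (ℕ.≤-<-trans (ℕ.m≤m+n j r) j<) (ℕ.<-≤-trans k< (ℕ.≤-trans (ℕ.m≤n+m c r) fits)) e)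
    separated {r} {c} {col j} {tip}   fits j<  _  e =
      contradiction (sym e) (tip≢col (ℕ.≤-<-trans (ℕ.m≤m+n j r) j<))

  Realises : (ℕ → Maybe ℕ) → (Vertex → ℕ) → State → ℕ → Set
  Realises A ℓ s M = ∀ v → InDomain (height s) (width s) M v → A (ℓ v) ≡ Maybe.map ℓ (status s v)

  -- `link` compares its argument with four vertices only, so injectivity is asked for there alone.
  -- A naming of labels is not injective on all vertices, because a label in the middle has two
  -- names.
  link-map : ∀ {X Y : Set} (_≟₁_ : DecidableEquality X) (_≟₂_ : DecidableEquality Y) (ℓ : X → Y)
    {A : Y → Maybe Y} {f x y p q v} →
    A (ℓ v) ≡ Maybe.map ℓ (f v) →
    (∀ {w} → w ≡ x ⊎ w ≡ y ⊎ w ≡ p ⊎ w ≡ q → ℓ v ≡ ℓ w → v ≡ w) →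
    link _≟₂_ A (ℓ x) (ℓ y) (ℓ p) (ℓ q) (ℓ v) ≡ Maybe.map ℓ (link _≟₁_ f x y p q v)
  link-map _≟₁_ _≟₂_ ℓ {A} {f} {x} {y} {p} {q} {v} Av inj
    rewrite does-⇔ (mk⇔ (inj (inj₂ (inj₂ (inj₁ refl)))) (cong ℓ)) (ℓ v ≟₂ ℓ p) (v ≟₁ p)
          | does-⇔ (mk⇔ (inj (inj₂ (inj₂ (inj₂ refl)))) (cong ℓ)) (ℓ v ≟₂ ℓ q) (v ≟₁ q)
          | does-⇔ (mk⇔ (inj (inj₁ refl)) (cong ℓ)) (ℓ v ≟₂ ℓ x) (v ≟₁ x)
          | does-⇔ (mk⇔ (inj (inj₂ (inj₁ refl))) (cong ℓ)) (ℓ v ≟₂ ℓ y) (v ≟₁ y)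
    with does (v ≟₁ p) | does (v ≟₁ q) | does (v ≟₁ x) | does (v ≟₁ y)
  ... | true  | _     | _     | _     = refl
  ... | false | true  | _     | _     = refl
  ... | false | false | true  | _     = refl
  ... | false | false | false | true  = refl
  ... | false | false | false | false = Av

  link-other : ∀ {X : Set} (_≟_ : DecidableEquality X) {f : X → Maybe X} {x y p q v} →
    v ≢ x → v ≢ y → v ≢ p → v ≢ q → link _≟_ f x y p q v ≡ f v
  link-other _≟_ {x = x} {y} {p} {q} {v} v≢x v≢y v≢p v≢q with v ≟ p | v ≟ q | v ≟ x | v ≟ y
  ... | yes e | _     | _     | _     = contradiction e v≢p
  ... | no _  | yes e | _     | _     = contradiction e v≢q
  ... | no _  | no _  | yes e | _     = contradiction e v≢x
  ... | no _  | no _  | no _  | yes e = contradiction e v≢y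
  ... | no _  | no _  | no _  | no _  = refl

  -- Names in the target window become names in the source window. `a` and `b` refer to rows and
  -- columns of the source also when the sides are exchanged.
  shift : Bool → ℕ → ℕ → Vertex → Vertex
  shift false a b (row i) = row (a + i)
  shift false a b (col j) = col (b + j)
  shift true  a b (row i) = col (b + i)
  shift true  a b (col j) = row (a + j)
  shift _     a b tip     = tip

  window : State → List Vertex
  window s = map row (upTo (height s)) ++ map col (upTo (width s))

  -- The edge joins a row with other end p to a column with other end q; target is the resulting window
  -- after dropping a rows and b columns and, if flip is set, exchanging rows and columns.
  record Move : Set where
    constructor mkMove
    field
      p q    : Vertex
      flip   : Bool
      a b    : ℕ
      target : State

  ShapeMatches : Bool → ℕ → ℕ → ℕ → ℕ → State → Set
  ShapeMatches false r c a b t = a + height t ≡ r × b + width t ≡ c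
  ShapeMatches true  r c a b t = a + width t ≡ r × b + height t ≡ c

  shapeMatches? : ∀ f r c a b t → Dec (ShapeMatches f r c a b t)
  shapeMatches? false r c a b t = (_ ℕ.≟ _) ×-dec (_ ℕ.≟ _)
  shapeMatches? true  r c a b t = (_ ℕ.≟ _) ×-dec (_ ℕ.≟ _)

  -- A finite check that does not mention `d`: it justifies the move in every configuration
  -- described by `s`, as long as the target window fits. `r` and `c` are the dimensions of the
  -- source window once extended to contain row `i` and column `j`.
  record Valid (s : State) (i : ℕ) (m : Move) : Set where
    constructor valid
    open Move m public

    j : ℕ
    j = level s ∸ i

    r : ℕ
    r = height s ⊔ suc i

    c : ℕ
    c = width s ⊔ suc j

    field
      i≤level   : i ≤ level s
      status-i  : status s (row i) ≡ just p
      status-j  : status s (col j) ≡ just q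
      p≢j       : p ≢ col j
      p∈window  : InWindow r c p
      q∈window  : InWindow r c q
      shape     : ShapeMatches flip r c a b target
      -- The next difference is one smaller, which raises the level by one; every dropped row or
      -- column lowers it by one.
      level≡    : a + b + level target ≡ suc (level s)
      on-window : All (λ v → link _≟ᵛ_ (status s) (row i) (col j) p q (shift flip a b v)
                               ≡ Maybe.map (shift flip a b) (status target v))
                    (window target)

  valid? : ∀ s i m → Dec (Valid s i m)
  valid? s i m = map′
    (λ (e₁ , e₂ , e₃ , e₄ , e₅ , e₆ , e₇ , e₈ , e₉) → valid e₁ e₂ e₃ e₄ e₅ e₆ e₇ e₈ e₉)
    (λ (valid e₁ e₂ e₃ e₄ e₅ e₆ e₇ e₈ e₉) → e₁ , e₂ , e₃ , e₄ , e₅ , e₆ , e₇ , e₈ , e₉)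
    ((i ℕ.≤? level s) ×-dec (_ ≟ᵐ _) ×-dec (_ ≟ᵐ _) ×-dec ¬? (p ≟ᵛ col (level s ∸ i))
    ×-dec inWindow? _ _ p ×-dec inWindow? _ _ q
    ×-dec shapeMatches? flip _ _ a b target ×-dec (_ ℕ.≟ _) ×-dec all? (λ v → _ ≟ᵐ _) (window target))
    where
    open Move m
    _≟ᵐ_ : DecidableEquality (Maybe Vertex)
    _≟ᵐ_ = Maybe.≡-dec _≟ᵛ_

  Fits : State → ℕ → Set
  Fits s M = height s + width s ≤ M

  -- Row 0 and column 0 are the ends of an interval of this many labels when d is the next difference.
  labels : State → ℕ → ℕ
  labels s d = suc (d + level s)

  -- The fit of the target is assumed and that of the source derived: bounds are built up from small
  -- `d` to large, against the direction of the moves.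
  module Advance (s : State) (i : ℕ) (m : Move) (d : ℕ)
    (v : Valid s i m) (fits : Fits (Move.target m) (labels (Move.target m) d)) where

    open Valid v renaming (target to t; flip to f; p∈window to p∈; q∈window to q∈)

    private
      M M′ : ℕ
      M  = labels s (suc d)
      M′ = labels t d

      x y : Vertex
      x = row i
      y = col j

      φ : Vertex → Vertex
      φ = shift f a b

      i+j≡ : i + j ≡ level s
      i+j≡ = ℕ.m+[n∸m]≡n i≤level

      x∈ : InWindow r c x
      x∈ = ℕ.m≤n⊔m (height s) (suc i)

      y∈ : InWindow r c y
      y∈ = ℕ.m≤n⊔m (width s) (suc j)

      M≡ : a + b + M′ ≡ M
      M≡ = trans (ring a b d (level t)) (trans (cong (λ z → suc (d + z)) level≡) (cong suc (ℕ.+-suc d (level s))))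
        where
        ring : ∀ a b d l → a + b + suc (d + l) ≡ suc (d + (a + b + l))
        ring = solve-∀

      size≡ : r + c ≡ a + b + (height t + width t)
      size≡ = go f shape
        where
        ring₁ : ∀ a b h w → (a + h) + (b + w) ≡ a + b + (h + w)
        ring₁ = solve-∀
        ring₂ : ∀ a b h w → (a + w) + (b + h) ≡ a + b + (h + w)
        ring₂ = solve-∀
        go : ∀ f → ShapeMatches f r c a b t → r + c ≡ a + b + (height t + width t)
        go false (e , e′) = trans (sym (cong₂ _+_ e e′)) (ring₁ a b (height t) (width t))
        go true  (e , e′) = trans (sym (cong₂ _+_ e e′)) (ring₂ a b (height t) (width t))

      fits⁺ : r + c ≤ M
      fits⁺ = subst₂ _≤_ (sym size≡) M≡ (ℕ.+-monoʳ-≤ (a + b) fits)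

      domain⁺⇒ : ∀ {v} → InDomain r c M v → InDomain (height s) (width s) M v
      domain⁺⇒ {row k} = ℕ.≤-<-trans (ℕ.+-monoʳ-≤ k (ℕ.m≤m⊔n (width s) (suc j)))
      domain⁺⇒ {col k} = ℕ.≤-<-trans (ℕ.+-monoʳ-≤ k (ℕ.m≤m⊔n (height s) (suc i)))

      x∈domain : InDomain r c M x
      x∈domain = ℕ.<-≤-trans (ℕ.+-monoˡ-< c x∈) fits⁺

      y∈domain : InDomain r c M y
      y∈domain = ℕ.<-≤-trans (ℕ.+-monoˡ-< r y∈) (subst (_≤ M) (ℕ.+-comm r c) fits⁺)

      lift-domain : ∀ {v} → InDomain (height t) (width t) M′ v → InDomain r c M (φ v)
      lift-domain {v} = go f shape v
        where
        ring : ∀ a k b w → (a + k) + (b + w) ≡ a + b + (k + w)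
        ring = solve-∀
        ring′ : ∀ a k b w → (b + k) + (a + w) ≡ a + b + (k + w)
        ring′ = solve-∀
        up : ∀ {z z′} → z ≡ a + b + z′ → z′ < M′ → z < M
        up {z′ = z′} refl z′< = subst (a + b + z′ <_) M≡ (ℕ.+-monoʳ-< (a + b) z′<)
        go : ∀ f → ShapeMatches f r c a b t → ∀ v →
          InDomain (height t) (width t) M′ v → InDomain r c M (shift f a b v)
        go false (e , e′) (row k) = up (trans (cong (a + k +_) (sym e′)) (ring a k b (width t)))
        go false (e , e′) (col k) = up (trans (cong (b + k +_) (sym e)) (ring′ a k b (height t)))
        go true  (e , e′) (row k) = up (trans (cong (b + k +_) (sym e)) (ring′ a k b (width t)))
        go true  (e , e′) (col k) = up (trans (cong (a + k +_) (sym e′)) (ring a k b (height t)))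

      outside : ∀ {v} → ¬ InWindow r c v → link _≟ᵛ_ (status s) x y p q v ≡ just v
      outside {v} v∉ = trans (link-other _≟ᵛ_ {f = status s} (differs x∈) (differs y∈) (differs p∈) (differs q∈)) (fresh v v∉)
        where
        differs : ∀ {w} → InWindow r c w → v ≢ w
        differs w∈ refl = v∉ w∈
        fresh : ∀ v → ¬ InWindow r c v → status s v ≡ just v
        fresh (row k) k∉ = entry-outside _ (rows s) (ℕ.≤-trans (ℕ.m≤m⊔n (height s) (suc i)) (ℕ.≮⇒≥ k∉))
        fresh (col k) k∉ = entry-outside _ (cols s) (ℕ.≤-trans (ℕ.m≤m⊔n (width s) (suc j)) (ℕ.≮⇒≥ k∉))
        fresh tip     t∉ = contradiction tt t∉

      lift-outside : ∀ {v} → ¬ InWindow (height t) (width t) v → ¬ InWindow r c (φ v)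
      lift-outside {v} = go f shape v
        where
        go : ∀ f → ShapeMatches f r c a b t → ∀ v →
          ¬ InWindow (height t) (width t) v → ¬ InWindow r c (shift f a b v)
        go false (e , e′) (row k) v∉ lt = v∉ (ℕ.+-cancelˡ-< a _ _ (subst (a + k <_) (sym e) lt))
        go false (e , e′) (col k) v∉ lt = v∉ (ℕ.+-cancelˡ-< b _ _ (subst (b + k <_) (sym e′) lt))
        go true  (e , e′) (row k) v∉ lt = v∉ (ℕ.+-cancelˡ-< b _ _ (subst (b + k <_) (sym e′) lt))
        go true  (e , e′) (col k) v∉ lt = v∉ (ℕ.+-cancelˡ-< a _ _ (subst (a + k <_) (sym e) lt))
        go _ _ tip v∉ _ = v∉ tt

      -- Inside the target window this was tested by `on-window`. Outside it both sides describe an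
      -- isolated vertex, since the extended source window contains all that the edge changes.
      target-status : ∀ v → v ≢ tip → link _≟ᵛ_ (status s) x y p q (φ v) ≡ Maybe.map φ (status t v)
      target-status v v≢tip with inWindow? (height t) (width t) v
      target-status (row k) _ | yes k< = All.lookup on-window (∈-++⁺ˡ (∈-map⁺ row (∈-upTo⁺ k<)))
      target-status (col k) _ | yes k< = All.lookup on-window (∈-++⁺ʳ (map row (upTo (height t))) (∈-map⁺ col (∈-upTo⁺ k<)))
      target-status tip v≢tip | yes _  = contradiction refl v≢tip
      target-status (row k) _ | no k∉  = trans (outside (lift-outside {row k} k∉))
        (sym (cong (Maybe.map φ) (entry-outside _ (rows t) (ℕ.≮⇒≥ k∉))))
      target-status (col k) _ | no k∉  = trans (outside (lift-outside {col k} k∉))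
        (sym (cong (Maybe.map φ) (entry-outside _ (cols t) (ℕ.≮⇒≥ k∉))))
      target-status tip v≢tip | no _   = contradiction refl v≢tip

    source-fits : Fits s M
    source-fits = ℕ.≤-trans (ℕ.+-mono-≤ (ℕ.m≤m⊔n (height s) (suc i)) (ℕ.m≤m⊔n (width s) (suc j))) fits⁺

    module _ (A : ℕ → Maybe ℕ) (ℓ : Vertex → ℕ) (frame : Frame ℓ M) (real : Realises A ℓ s M) where
      open Frame frame

      at-x : A (ℓ x) ≡ just (ℓ p)
      at-x = trans (real x (domain⁺⇒ {x} x∈domain)) (cong (Maybe.map ℓ) status-i)

      at-y : A (ℓ y) ≡ just (ℓ q)
      at-y = trans (real y (domain⁺⇒ {y} y∈domain)) (cong (Maybe.map ℓ) status-j)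

      other-end : ℓ p ≢ ℓ y
      other-end e = p≢j (sym (separated {v = y} {p} fits⁺ y∈domain p∈ (sym e)))

      gap : ∣ ℓ x - ℓ y ∣ ≡ suc d
      gap = distance (cong suc (trans (cong (_+ suc d) i+j≡) (ℕ.+-comm (level s) (suc d))))

      target-realised : Realises (link ℕ._≟_ A (ℓ x) (ℓ y) (ℓ p) (ℓ q)) (ℓ ∘ φ) t M′
      target-realised v v∈ = trans
        (link-map _≟ᵛ_ ℕ._≟_ ℓ {A} {status s} (real (φ v) (domain⁺⇒ {φ v} (lift-domain {v} v∈))) near)
        (trans (cong (Maybe.map ℓ) (target-status v v≢tip)) (sym (Maybe.map-∘ (status t v))))
        where
        v≢tip : v ≢ tip
        v≢tip refl = v∈
        near : ∀ {w} → w ≡ x ⊎ w ≡ y ⊎ w ≡ p ⊎ w ≡ q → ℓ (φ v) ≡ ℓ w → φ v ≡ w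
        near (inj₁ refl)               = separated fits⁺ (lift-domain {v} v∈) x∈
        near (inj₂ (inj₁ refl))        = separated fits⁺ (lift-domain {v} v∈) y∈
        near (inj₂ (inj₂ (inj₁ refl))) = separated fits⁺ (lift-domain {v} v∈) p∈
        near (inj₂ (inj₂ (inj₂ refl))) = separated fits⁺ (lift-domain {v} v∈) q∈

      target-frame : Frame (ℓ ∘ φ) M′
      target-frame = go f
        where
        b+ : ∀ {k} → k < M′ → b + k < M
        b+ {k} k< = subst (b + k <_) M≡ (ℕ.+-mono-≤-< (ℕ.m≤n+m b a) k<)
        a+ : ∀ {k} → k < M′ → a + k < M
        a+ {k} k< = subst (a + k <_) M≡ (ℕ.+-mono-≤-< (ℕ.m≤m+n a b) k<)
        ring : ∀ a b i j t → suc ((a + i) + (b + j) + t) ≡ a + b + suc (i + j + t)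
        ring = solve-∀
        ring′ : ∀ a b i j t → suc ((a + j) + (b + i) + t) ≡ a + b + suc (i + j + t)
        ring′ = solve-∀
        go : ∀ f → Frame (ℓ ∘ shift f a b) M′
        go false = record
          { row-injective = λ i< j< e → ℕ.+-cancelˡ-≡ a _ _ (row-injective (a+ i<) (a+ j<) e)
          ; col-injective = λ i< j< e → ℕ.+-cancelˡ-≡ b _ _ (col-injective (b+ i<) (b+ j<) e)
          ; tip≢row = tip≢row ∘ a+
          ; tip≢col = tip≢col ∘ b+
          ; distance = λ {i} {j} {t} e → distance (trans (ring a b i j t) (trans (cong (a + b +_) e) M≡))
          }
        go true = record
          { row-injective = λ i< j< e → ℕ.+-cancelˡ-≡ b _ _ (col-injective (b+ i<) (b+ j<) e)
          ; col-injective = λ i< j< e → ℕ.+-cancelˡ-≡ a _ _ (row-injective (a+ i<) (a+ j<) e)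
          ; tip≢row = tip≢col ∘ b+
          ; tip≢col = tip≢row ∘ a+
          ; distance = λ {i} {j} {t} e → trans (ℕ.∣-∣-comm (ℓ (col (b + i))) (ℓ (row (a + j))))
              (distance (trans (ring′ a b i j t) (trans (cong (a + b +_) e) M≡)))
          }

open Windows

-- Transitions between encoded windows, and additive lower bounds along them.

module Transitions where
  open import Data.Bool.Base using (Bool; true; false; if_then_else_)
  open import Data.Bool.ListAction using (any)
  open import Data.List.Base as List using (List; []; _∷_; _++_; length; map; upTo; filter; foldr)
  import Data.List.Properties as List
  open import Data.List.Membership.Propositional using (_∈_)
  open import Data.List.Membership.Propositional.Properties using (∈-filter⁻)
  open import Data.List.Relation.Unary.Any using (here; there)
  open import Data.List.Relation.Unary.Unique.Propositional using (Unique)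
  import Data.List.Relation.Unary.Unique.Propositional.Properties as Unique
  open import Data.Maybe.Base as Maybe using (Maybe; just; nothing; fromMaybe)
  open import Data.Nat.Base
  open import Data.Nat.DivMod using (_/_; _%_)
  open import Data.Nat.ListAction using (sum)
  import Data.Nat.Properties as ℕ
  open import Data.Product.Base using (∃; _×_; _,_; proj₁; proj₂)
  open import Data.Sum.Base using (inj₁; inj₂)
  open import Function.Base using (_∘_)
  open import Relation.Binary.PropositionalEquality
    using (_≡_; _≢_; refl; sym; trans; cong; cong₂; subst)
  open import Relation.Nullary.Decidable using (Dec; yes; no)
  open import Relation.Nullary.Negation using (contradiction)
  open State

  -- Base 16 suffices since all windows met below are at most 7 × 7; no proof depends on this, because
  -- a move is checked against the decoded key of its target.
  digit : Maybe Vertex → ℕ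
  digit nothing        = 0
  digit (just tip)     = 1
  digit (just (row i)) = 2 + 2 * i
  digit (just (col j)) = 3 + 2 * j

  undigit : ℕ → Maybe Vertex
  undigit 0             = nothing
  undigit 1             = just tip
  undigit (suc (suc n)) = just ((if n % 2 ≡ᵇ 0 then row else col) (n / 2))

  encode : State → ℕ
  encode (state e R C) = foldr (λ d k → d + 16 * k) 0 (e ∷ length R ∷ length C ∷ map digit (R ++ C))

  decode : ℕ → State
  decode k = state (k % 16) (List.take h cells) (List.drop h cells)
    where
    undigits : ℕ → ℕ → List (Maybe Vertex)
    undigits zero    k = []
    undigits (suc l) k = undigit (k % 16) ∷ undigits l (k / 16)
    h : ℕ
    h = k / 16 % 16
    cells : List (Maybe Vertex)
    cells = undigits (h + k / 256 % 16) (k / 4096)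

  unshift : Bool → ℕ → ℕ → Vertex → Vertex
  unshift false a b (row i) = row (i ∸ a)
  unshift false a b (col j) = col (j ∸ b)
  unshift true  a b (row i) = col (i ∸ a)
  unshift true  a b (col j) = row (j ∸ b)
  unshift _     a b tip     = tip

  -- Discards leading saturated rows and columns, and exchanges rows and columns if needed to have the
  -- end belonging to the tip among the columns.
  normalise : ℕ → List (Maybe Vertex) → List (Maybe Vertex) → Bool × ℕ × ℕ × State
  normalise e R C = f , a , b , (if f then state e′ C′ R′ else state e′ R′ C′)
    where
    dropSaturated : List (Maybe Vertex) → List (Maybe Vertex)
    dropSaturated (nothing ∷ xs) = dropSaturated xs
    dropSaturated xs             = xs
    isTip : Maybe Vertex → Bool
    isTip (just tip) = true
    isTip _          = false
    R₁ C₁ R′ C′ : List (Maybe Vertex)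
    a b e′ : ℕ
    f  : Bool
    R₁ = dropSaturated R
    C₁ = dropSaturated C
    a  = length R ∸ length R₁
    b  = length C ∸ length C₁
    e′ = suc e ∸ (a + b)
    f  = any isTip R₁
    R′ = map (Maybe.map (unshift f a b)) R₁
    C′ = map (Maybe.map (unshift f a b)) C₁

  -- A bound valid for all `n` and all configurations that look like `s`. Asking for the fit only
  -- when `c` is nonzero makes 0 a bound everywhere, also at windows too large for their interval.
  record Completable (s : State) (d c : ℕ) : Set where
    field
      fits  : c ≢ 0 → Fits s (labels s d)
      total : ∀ {n A ℓ S} → Frame ℓ (labels s d) → Realises A ℓ s (labels s d) → Partial n A S d →
              Count (Completion n S) c

  completable-0 : ∀ {s d} → Completable s d 0
  completable-0 = record { fits = λ 0≢0 → contradiction refl 0≢0 ; total = λ _ _ _ → count-0 }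

  sum≢0 : ∀ (c : ℕ → ℕ) is → sum (map c is) ≢ 0 → ∃ λ i → i ∈ is × c i ≢ 0
  sum≢0 c []       s≢0 = contradiction refl s≢0
  sum≢0 c (i ∷ is) s≢0 with c i ℕ.≟ 0
  ... | no ci≢0 = i , here refl , ci≢0
  ... | yes ci≡0 with k , k∈ , ck≢0 ← sum≢0 c is (λ e → s≢0 (cong₂ _+_ ci≡0 e)) = k , there k∈ , ck≢0

  linked-count : ∀ {n A S d x y p q c} → Partial n A S (suc d) →
    A x ≡ just p → A y ≡ just q → p ≢ y → ∣ x - y ∣ ≡ suc d →
    (∀ {S′} → Partial n (link ℕ._≟_ A x y p q) S′ d → Count (Completion n S′) c) →
    Count (λ P → Completion n S P × Adjacent P x y) c
  linked-count 𝒫 Ax Ay p≢y d≡ counts with S′ , 𝒫′ , contains ← linked 𝒫 Ax Ay p≢y d≡ = count-map extend (counts 𝒫′)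
    where
    extend : ∀ {P} → Completion _ S′ P → Completion _ _ P × Adjacent P _ _
    extend {P} (completion P↭ ds↭ S′⊑) with S⊑ , adj ← contains P S′⊑ = completion P↭ ds↭ S⊑ , adj

  advance-count : ∀ {s i m d c n A ℓ S} → Valid s i m → Completable (Move.target m) d c →
    Frame ℓ (labels s (suc d)) → Realises A ℓ s (labels s (suc d)) → Partial n A S (suc d) →
    Count (λ P → Completion n S P × Adjacent P (ℓ (row i)) (ℓ (col (level s ∸ i)))) c
  advance-count {s} {i} {m} {d} {c} {n} {A} {ℓ} v C frame real 𝒫 = go (c ℕ.≟ 0)
    where
    go : Dec (c ≡ 0) → _
    go (yes refl) = count-0
    go (no c≢0) = linked-count 𝒫 (at-x A ℓ frame real) (at-y A ℓ frame real)
      (other-end A ℓ frame real) (gap A ℓ frame real)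
      (Completable.total C (target-frame A ℓ frame real) (target-realised A ℓ frame real))
      where open Advance s i m d v (Completable.fits C c≢0)

  module _ {s : State} {d n : ℕ} {ℓ : Vertex → ℕ} {S : List (List ℕ)} {is : List ℕ} (is! : Unique is)
    (is≤ : ∀ {i} → i ∈ is → i ≤ level s) (c : ℕ → ℕ) (frame : Frame ℓ (labels s (suc d))) where
    open Frame frame
    private
      x y : ℕ → ℕ
      x i = ℓ (row i)
      y i = ℓ (col (level s ∸ i))

      <labels : ∀ {i} → i ≤ level s → i < labels s (suc d)
      <labels i≤ = s≤s (ℕ.≤-trans i≤ (ℕ.m≤n+m (level s) (suc d)))

      apart : ∀ {i k} → i ≤ k → k ≤ level s → x i ≢ y k
      -- The indices add up to at most `level s`, which is below the sum at which a row and a column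
      -- are the same label.
      apart {i} {k} i≤k k≤ = row≢col (s≤s (s≤s (ℕ.≤-trans
        (ℕ.≤-trans (ℕ.+-monoˡ-≤ (level s ∸ k) i≤k) (ℕ.≤-reflexive (ℕ.m+[n∸m]≡n k≤))) (ℕ.m≤n+m (level s) d))))

      distinct : ∀ {i k} → i ∈ is → k ∈ is → SameEdge (x i) (y i) (x k) (y k) → i ≡ k
      distinct i∈ k∈ (inj₁ (e , _)) = row-injective (<labels (is≤ i∈)) (<labels (is≤ k∈)) e
      -- Were the edges equal crosswise, the smaller row would coincide with the column that belongs
      -- to the larger one.
      distinct {i} {k} i∈ k∈ (inj₂ (e , e′)) with ℕ.≤-total i k
      ... | inj₁ i≤k = contradiction e (apart i≤k (is≤ k∈))
      ... | inj₂ k≤i = contradiction (sym e′) (apart k≤i (is≤ i∈))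

      gap : ∀ {i} → i ∈ is → ∣ x i - y i ∣ ≡ suc d
      gap i∈ = distance (cong suc (trans (cong (_+ suc d) (ℕ.m+[n∸m]≡n (is≤ i∈))) (ℕ.+-comm (level s) (suc d))))

    count-antidiagonal : (∀ {i} → i ∈ is →
        Count (λ P → Completion n S P × Adjacent P (ℓ (row i)) (ℓ (col (level s ∸ i)))) (c i)) →
      Count (Completion n S) (sum (map c is))
    count-antidiagonal = count-sum x y c is is! gap distinct

  -- The bounds add up because different rows give different edges for the difference `suc d`. A
  -- single nonzero summand already shows that `s` fits.
  completable-sum : ∀ {s d is} → Unique is → (m : ℕ → Move) → (∀ {i} → i ∈ is → Valid s i (m i)) →
    (c : ℕ → ℕ) → (∀ i → Completable (Move.target (m i)) d (c i)) → Completable s (suc d) (sum (map c is))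
  completable-sum {s} {d} {is} is! m v c IH = record
    { fits  = λ s≢0 → source (sum≢0 c is s≢0)
    ; total = λ {n} {A} {ℓ} frame real 𝒫 → count-antidiagonal {s} {d} {n} {ℓ} is!
                (λ i∈ → Valid.i≤level (v i∈)) c frame
                (λ {i} i∈ → advance-count {A = A} (v i∈) (IH i) frame real 𝒫)
    }
    where
    source : (∃ λ i → i ∈ is × c i ≢ 0) → Fits s (labels s (suc d))
    source (i , i∈ , c≢0) = Advance.source-fits s i (m i) d (v i∈) (Completable.fits (IH i) c≢0)

  module _ (s : State) (i : ℕ) where
    private
      p q : Vertex
      -- For a saturated row or column the default does no harm: `valid?` then fails on `status-i`
      -- or `status-j`.
      p = fromMaybe tip (status s (row i))
      q = fromMaybe tip (status s (col (level s ∸ i)))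

      after : Vertex → Maybe Vertex
      after = link _≟ᵛ_ (status s) (row i) (col (level s ∸ i)) p q

      placed : Bool × ℕ × ℕ × State
      placed = normalise (level s) (map (after ∘ row) (upTo (height s ⊔ suc i)))
                                   (map (after ∘ col) (upTo (width s ⊔ suc (level s ∸ i))))

    key : ℕ
    key = encode (proj₂ (proj₂ (proj₂ placed)))

    move : Move
    move = mkMove p q (proj₁ placed) (proj₁ (proj₂ placed)) (proj₁ (proj₂ (proj₂ placed))) (decode key)

  -- Since only moves that pass `valid?` are kept, no property of `normalise` has to be proved; a
  -- rejected move could only weaken the bound.
  choices : State → List ℕ
  choices s = filter (λ i → valid? s i (move s i)) (upTo (suc (level s)))

  successors : State → List ℕ
  successors s = map (key s) (choices s)

  completable-step : ∀ {d} (f : ℕ → ℕ) → (∀ k → Completable (decode k) d (f k)) →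
    ∀ s → Completable s (suc d) (sum (map f (successors s)))
  completable-step {d} f IH s = subst (λ ks → Completable s (suc d) (sum ks)) (List.map-∘ (choices s))
    (completable-sum (Unique.filter⁺ (λ i → valid? s i (move s i)) (Unique.upTo⁺ (suc (level s)))) (move s)
      (λ i∈ → proj₂ (∈-filter⁻ (λ i → valid? s i (move s i)) {xs = upTo (suc (level s))} i∈))
      (f ∘ key s) (λ i → IH (key s i)))

open Transitions

-- The zigzag path as starting configuration.

module StartConfiguration where
  open import Data.List.Base as List using (List; []; _∷_; _++_; map; concat; reverse; upTo; applyUpTo; applyDownFrom)
  import Data.List.Properties as List
  open import Data.List.Membership.Propositional.Properties using (∈-map⁺; ∈-applyUpTo⁺)
  open import Data.List.Relation.Binary.Permutation.Propositional
    using (_↭_; prep; ↭-refl; ↭-sym; module PermutationReasoning)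
  import Data.List.Relation.Binary.Permutation.Propositional.Properties as Perm
  open import Data.List.Relation.Ternary.Interleaving.Propositional
    using (Interleaving; []; consˡ; consʳ; toPermutation)
  open import Data.List.Relation.Unary.Any using (here; there)
  open import Data.Maybe.Base using (Maybe; just; nothing)
  open import Data.Nat.Base
  import Data.Nat.Properties as ℕ
  open import Data.Product.Base using (_,_)
  open import Data.Sum.Base using (inj₁)
  open import Function.Base using (id)
  open import Relation.Binary.PropositionalEquality as ≡
    using (_≡_; refl; sym; trans; cong; subst; subst₂)
  open import Relation.Nullary.Decidable using (yes; no)
  open import Relation.Nullary.Negation using (contradiction)

  applyUpTo-+ : ∀ {X : Set} (f : ℕ → X) k n →
    applyUpTo f (k + n) ↭ applyDownFrom (λ i → f (i + n)) k ++ applyUpTo f n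
  applyUpTo-+ f zero    n = ↭-refl
  applyUpTo-+ f (suc k) n = begin
    applyUpTo f (suc (k + n))              ≡⟨ List.applyUpTo-∷ʳ f (k + n) ⟨
    applyUpTo f (k + n) List.∷ʳ f (k + n)  ↭⟨ Perm.∷↭∷ʳ (f (k + n)) _ ⟨
    f (k + n) ∷ applyUpTo f (k + n)        ↭⟨ prep _ (applyUpTo-+ f k n) ⟩
    _                                      ∎
    where open PermutationReasoning

  -- Of `14 + d` labels, 0 to 6 are dropped rows, 6 being the tip; row 0 is label 7, and column 0 is
  -- label `13 + d`, the other end of the path. Row `i` and column `j` differ by `6 + d - (i + j)`,
  -- hence level 6.
  startState : State
  startState = state 6 [] (just tip ∷ List.replicate 6 nothing)

  module Start (d : ℕ) where
    lows highs core path : List ℕ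
    lows  = 6 ∷ 5 ∷ 4 ∷ 3 ∷ 2 ∷ 1 ∷ 0 ∷ []
    highs = 7 + d ∷ 8 + d ∷ 9 + d ∷ 10 + d ∷ 11 + d ∷ 12 + d ∷ 13 + d ∷ []
    core  = applyUpTo (7 +_) d
    path  = 6 ∷ 7 + d ∷ 5 ∷ 8 + d ∷ 4 ∷ 9 + d ∷ 3 ∷ 10 + d ∷ 2 ∷ 11 + d ∷ 1 ∷ 12 + d ∷ 0 ∷ 13 + d ∷ []

    segments : List (List ℕ)
    segments = path ∷ map List.[_] core

    path-zigzag : Interleaving lows highs path
    path-zigzag = consˡ (consʳ (consˡ (consʳ (consˡ (consʳ (consˡ (consʳ (consˡ (consʳ (consˡ (consʳ (consˡ (consʳ [])))))))))))))

    -- Label 6 gets `nothing` although it is an end: as the tip it is never joined, and `Partial`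
    -- constrains only the entries that are `just`.
    other : ℕ → Maybe ℕ
    other z with z ℕ.≟ 13 + d | 7 ℕ.≤? z | z ℕ.<? 7 + d
    ... | yes _ | _     | _     = just 6
    ... | no _  | yes _ | yes _ = just z
    ... | no _  | yes _ | no _  = nothing
    ... | no _  | no _  | _     = nothing

    other-end : other (13 + d) ≡ just 6
    other-end with 13 + d ℕ.≟ 13 + d
    ... | yes _ = refl
    ... | no ≢  = contradiction refl ≢

    other-core : ∀ {i} → i < d → other (7 + i) ≡ just (7 + i)
    other-core {i} i<d with 7 + i ℕ.≟ 13 + d | 7 ℕ.≤? 7 + i | 7 + i ℕ.<? 7 + d
    ... | no _  | yes _ | yes _  = refl
    ... | yes e | _     | _      = contradiction (ℕ.+-cancelˡ-≡ 7 i (6 + d) e) (ℕ.<⇒≢ (ℕ.<-≤-trans i<d (ℕ.m≤n+m d 6)))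
    ... | no _  | yes _ | no ≮   = contradiction (ℕ.+-monoʳ-< 7 i<d) ≮
    ... | no _  | no ≰  | _      = contradiction (ℕ.m≤m+n 7 i) ≰

    other-high : ∀ {i} → i < 6 → other (7 + i + d) ≡ nothing
    other-high {i} i<6 with 7 + i + d ℕ.≟ 13 + d | 7 ℕ.≤? 7 + i + d | 7 + i + d ℕ.<? 7 + d
    ... | no _  | yes _ | no _   = refl
    ... | no _  | no _  | _      = refl
    ... | yes e | _     | _      = contradiction (ℕ.+-cancelˡ-≡ 7 i 6 (ℕ.+-cancelʳ-≡ d (7 + i) 13 e)) (ℕ.<⇒≢ i<6)
    ... | no _  | yes _ | yes lt = contradiction (ℕ.+-monoˡ-≤ d (ℕ.m≤m+n 7 i)) (ℕ.<⇒≱ lt)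

    other⇒segment : ∀ {x y} → other x ≡ just y → Segment segments x y
    other⇒segment {x} e with x ℕ.≟ 13 + d | 7 ℕ.≤? x | x ℕ.<? 7 + d
    other⇒segment refl | yes refl | _ | _ =
      segment-sym {S = segments} (path , inj₁ (here refl) , (_ , refl) , (List.take 13 path , refl))
    other⇒segment {x} refl | no _ | yes 7≤x | yes x< with o , refl ← ℕ.m≤n⇒∃[o]m+o≡n 7≤x =
      List.[ x ] , inj₁ (there (∈-map⁺ List.[_] (∈-applyUpTo⁺ (7 +_) (ℕ.+-cancelˡ-< 7 o d x<)))) , ([] , refl) , ([] , refl)

    differences-singletons : ∀ xs → concat (map differences (map List.[_] xs)) ≡ []
    differences-singletons []       = refl
    differences-singletons (_ ∷ xs) = differences-singletons xs

    partial : Partial (14 + d) other segments d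
    partial = record
      { vertices = begin
          path ++ concat (map List.[_] core)                 ≡⟨ cong (path ++_) (List.concat-map-[_] core) ⟩
          path ++ core                                       ↭⟨ Perm.++⁺ʳ core (toPermutation path-zigzag) ⟩
          (lows ++ highs) ++ core                            ↭⟨ Perm.++⁺ʳ core (Perm.++-comm lows highs) ⟩
          (highs ++ lows) ++ core
            ↭⟨ Perm.++⁺ʳ core (Perm.++⁺ (↭-sym (Perm.↭-reverse highs)) (↭-sym (Perm.↭-reverse lows))) ⟩
          (reverse highs ++ reverse lows) ++ core            ↭⟨ applyUpTo-+ id 7 (7 + d) ⟨
          upTo (14 + d)                                      ∎
      -- Along the path the differences rise from `d + 1` to `d + 13`, hence the reversal.
      ; edges    = begin
          (differences path ++ concat (map differences (map List.[_] core))) ++ oneToPred (suc d)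
            ≡⟨ cong (λ z → (differences path ++ z) ++ oneToPred (suc d)) (differences-singletons core) ⟩
          differences path ++ applyUpTo suc d
            ↭⟨ Perm.++⁺ʳ (applyUpTo suc d) (Perm.↭-reverse (differences path)) ⟨
          reverse (differences path) ++ applyUpTo suc d
            ↭⟨ applyUpTo-+ suc 13 d ⟨
          oneToPred (14 + d) ∎
      ; number   = cong suc (trans (List.length-map List.[_] core) (List.length-applyUpTo (7 +_) d))
      ; segment  = other⇒segment
      }
      where open PermutationReasoning

    label : Vertex → ℕ
    label (row i) = 7 + i
    label (col j) = 13 + d ∸ j
    label tip     = 6

    M≡ : labels startState d ≡ 7 + d
    M≡ = cong suc (ℕ.+-comm d 6)

    col≤ : ∀ {j} → j < labels startState d → j ≤ 13 + d
    col≤ {j} j< = ℕ.≤-trans (ℕ.<⇒≤ (subst (j <_) M≡ j<)) (ℕ.m≤n+m (7 + d) 6)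

    frame : Frame label (labels startState d)
    frame = record
      { row-injective = λ _ _ → ℕ.+-cancelˡ-≡ 7 _ _
      ; col-injective = λ i< j< → ℕ.∸-cancelˡ-≡ (col≤ i<) (col≤ j<)
      ; tip≢row = λ _ ()
      ; tip≢col = λ {j} j< e → ℕ.<⇒≢ (subst (j <_) M≡ j<)
          (ℕ.+-cancelˡ-≡ 6 j (7 + d) (trans (cong (_+ j) e) (ℕ.m∸n+n≡m (col≤ j<))))
      ; distance = λ {i} {j} {t} e → distance {i} {j} {t} (ℕ.suc-injective e)
      }
      where
      distance : ∀ {i j t} → i + j + t ≡ d + 6 → ∣ 7 + i - (13 + d ∸ j) ∣ ≡ t
      distance {i} {j} {t} e = trans (cong (λ z → ∣ 7 + i - z ∣) high≡) (ℕ.∣m-m+n∣≡n (7 + i) t)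
        where
        high≡ : 13 + d ∸ j ≡ 7 + i + t
        high≡ = trans (cong (_∸ j) (begin
          13 + d          ≡⟨ cong (7 +_) (ℕ.+-comm 6 d) ⟩
          7 + (d + 6)     ≡⟨ cong (7 +_) e ⟨
          7 + (i + j + t) ≡⟨ cong (7 +_) (ℕ.+-assoc i j t) ⟩
          7 + (i + (j + t)) ≡⟨ cong (λ z → 7 + (i + z)) (ℕ.+-comm j t) ⟩
          7 + (i + (t + j)) ≡⟨ cong (7 +_) (ℕ.+-assoc i t j) ⟨
          7 + (i + t + j) ∎)) (ℕ.m+n∸n≡m (7 + i + t) j)
          where open ≡.≡-Reasoning

    at-open : ∀ {z} → z ≡ 13 + d → other z ≡ just 6
    at-open refl = other-end

    at-high : ∀ {z} i → i < 6 → z ≡ 7 + i + d → other z ≡ nothing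
    at-high i i<6 refl = other-high i<6

    at-core : ∀ {z} i → i < d → z ≡ 7 + i → other z ≡ just z
    at-core i i<d refl = other-core i<d

    realised : Realises other label startState (labels startState d)
    realised (row i) i< = at-core i (ℕ.+-cancelʳ-< 7 i d (subst (i + 7 <_) (trans M≡ (ℕ.+-comm 7 d)) i<)) refl
    realised (col 0) _  = at-open refl
    realised (col 1) _  = at-high 5 ℕ.≤-refl refl
    realised (col 2) _  = at-high 4 (ℕ.m≤n+m 5 1) refl
    realised (col 3) _  = at-high 3 (ℕ.m≤n+m 4 2) refl
    realised (col 4) _  = at-high 2 (ℕ.m≤n+m 3 3) refl
    realised (col 5) _  = at-high 1 (ℕ.m≤n+m 2 4) refl
    realised (col 6) _  = at-high 0 (ℕ.m≤n+m 1 5) refl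
    -- From column 7 on the labels belong to `core`, counted from its upper end.
    realised (col (suc (suc (suc (suc (suc (suc (suc j)))))))) j< =
      at-core (d ∸ suc j) (ℕ.∸-monoʳ-< z<s j<d) (core≡ j<d)
      where
      j<d : j < d
      j<d = ℕ.+-cancelˡ-< 7 j d (subst₂ _<_ (ℕ.+-identityʳ (7 + j)) M≡ j<)
      core≡ : suc j ≤ d → 6 + d ∸ j ≡ 7 + (d ∸ suc j)
      core≡ j<d = trans (cong (λ z → 6 + z ∸ j) (sym (ℕ.m+[n∸m]≡n j<d)))
        (trans (cong (_∸ j) (cong (7 +_) (ℕ.+-comm j _))) (ℕ.m+n∸n≡m (7 + (d ∸ suc j)) j))

  completable-start⇒≤G : ∀ {d c} → Completable startState d c → c ≤ G (14 + d)
  completable-start⇒≤G {d} C = count⇒≤G {14 + d} {segments}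
    (Completable.total C {14 + d} {other} {label} {segments} frame realised partial)
    where open Start d

open StartConfiguration

-- Counting walks in the explored graph, and the growth of the bounds.

module Walks where
  open import Data.Bool.Base using (Bool; true; false; if_then_else_; _∧_; T)
  import Data.Bool.Properties as Bool
  open import Data.List.Base using (List; []; _∷_; _++_; map)
  open import Data.Maybe.Base as Maybe using (Maybe; just; nothing; fromMaybe; is-just)
  open import Data.Maybe.Properties using (just-injective)
  open import Data.Nat.Base
  open import Data.Nat.DivMod using (_/_; _%_; m≡m%n+[m/n]*n; m%n<n)
  open import Data.Nat.ListAction using (sum)
  import Data.Nat.Properties as ℕ
  open import Data.Nat.Tactic.RingSolver using (solve-∀)
  open import Data.Product.Base using (∃; _×_; _,_; proj₁; proj₂)
  open import Data.Sum.Base using (_⊎_; inj₁; inj₂)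
  open import Function.Bundles using (Equivalence)
  open import Relation.Binary.PropositionalEquality
    using (_≡_; refl; sym; trans; cong; cong₂; subst; subst₂)

  data Tree (X : Set) : Set where
    leaf : Tree X
    node : Tree X → ℕ → X → Tree X → Tree X

  private variable
    X Y : Set

  insert : ℕ → X → Tree X → Tree X
  insert k x leaf             = node leaf k x leaf
  insert k x (node l k′ y r) = if k <ᵇ k′ then node (insert k x l) k′ y r else node l k′ y (insert k x r)

  lookup : Tree X → ℕ → Maybe X
  lookup leaf             k = nothing
  lookup (node l k′ y r) k = if k <ᵇ k′ then lookup l k else if k ≡ᵇ k′ then just y else lookup r k

  mapTree : (X → Y) → Tree X → Tree Y
  mapTree f leaf           = leaf
  mapTree f (node l k x r) = node (mapTree f l) k (f x) (mapTree f r)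

  allNodes : (ℕ → X → Bool) → Tree X → Bool
  allNodes f leaf           = true
  allNodes f (node l k x r) = allNodes f l ∧ f k x ∧ allNodes f r

  -- Holds for unordered trees too: `insert` only replaces a leaf, and the comparisons made by a
  -- lookup above it are unchanged.
  lookup-insert : ∀ k (x : X) t {k′ y} → lookup (insert k x t) k′ ≡ just y →
    (k′ ≡ k × y ≡ x) ⊎ lookup t k′ ≡ just y
  lookup-insert k x leaf {k′} e with k′ <ᵇ k
  ... | true = inj₂ e
  ... | false with k′ ≡ᵇ k in k′≡ᵇk
  ...   | true  = inj₁ (ℕ.≡ᵇ⇒≡ k′ k (Equivalence.from Bool.T-≡ k′≡ᵇk) , sym (just-injective e))
  ...   | false = inj₂ e
  lookup-insert k x (node l k₀ z r) {k′} e with k <ᵇ k₀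
  ... | true with k′ <ᵇ k₀
  ...   | true  = lookup-insert k x l e
  ...   | false = inj₂ e
  lookup-insert k x (node l k₀ z r) {k′} e | false with k′ <ᵇ k₀ | k′ ≡ᵇ k₀
  ... | true  | _     = inj₂ e
  ... | false | true  = inj₂ e
  ... | false | false = lookup-insert k x r e

  lookup-mapTree : ∀ (f : X → Y) t k → lookup (mapTree f t) k ≡ Maybe.map f (lookup t k)
  lookup-mapTree f leaf            k = refl
  lookup-mapTree f (node l k′ x r) k with k <ᵇ k′ | k ≡ᵇ k′
  ... | true  | _     = lookup-mapTree f l k
  ... | false | true  = refl
  ... | false | false = lookup-mapTree f r k

  allNodes-lookup : ∀ (f : ℕ → X → Bool) t {k x} → T (allNodes f t) → lookup t k ≡ just x → T (f k x)
  allNodes-lookup f (node l k′ y r) {k} all e with k <ᵇ k′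
  ... | true = allNodes-lookup f l (proj₁ (Equivalence.to Bool.T-∧ all)) e
  ... | false with k ≡ᵇ k′ in k≡ᵇk′
  ...   | false = allNodes-lookup f r (proj₂ (Equivalence.to Bool.T-∧ (proj₂ (Equivalence.to (Bool.T-∧ {allNodes f l}) all)))) e
  ...   | true  = subst₂ (λ k y → T (f k y)) (sym (ℕ.≡ᵇ⇒≡ k k′ (Equivalence.from Bool.T-≡ k≡ᵇk′))) (just-injective e)
    (proj₁ (Equivalence.to Bool.T-∧ (proj₂ (Equivalence.to (Bool.T-∧ {allNodes f l}) all))))

  value : Tree ℕ → ℕ → ℕ
  value t k = fromMaybe 0 (lookup t k)

  Graph : Set
  Graph = Tree (List ℕ)

  -- One-sided: vertices may be missing, which merely lowers the number of walks counted.
  Faithful : (ℕ → List ℕ) → Graph → Set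
  Faithful next g = ∀ {k ks} → lookup g k ≡ just ks → ks ≡ next k

  module _ (next : ℕ → List ℕ) where
    -- Breadth-first search, faithful for any amount of fuel. `visit` takes `next k` as an argument
    -- so that one evaluation serves both the queue and the graph.
    explore : ℕ → List ℕ → Graph → Graph
    visit   : ℕ → ℕ → List ℕ → List ℕ → Graph → Graph

    explore zero       ks       g = g
    explore (suc fuel) []       g = g
    explore (suc fuel) (k ∷ ks) g = if is-just (lookup g k) then explore fuel ks g else visit fuel k ks (next k) g

    visit fuel k ks js g = explore fuel (ks ++ js) (insert k js g)

    insert-faithful : ∀ {g k} → Faithful next g → Faithful next (insert k (next k) g)
    insert-faithful {g} {k} F e with lookup-insert k (next k) g e
    ... | inj₁ (refl , refl) = refl
    ... | inj₂ e′            = F e′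

    explore-faithful : ∀ fuel ks {g} → Faithful next g → Faithful next (explore fuel ks g)
    explore-faithful zero       ks       F = F
    explore-faithful (suc fuel) []       F = F
    explore-faithful (suc fuel) (k ∷ ks) {g} F with is-just (lookup g k)
    ... | true  = explore-faithful fuel ks F
    ... | false = explore-faithful fuel (ks ++ next k) (insert-faithful {g} F)

  neighbours : ℕ → List ℕ
  neighbours k = successors (decode k)

  startKey : ℕ
  startKey = encode startState

  -- value (walks g n) k is the number of walks of length n from k to startKey.
  round : Graph → Tree ℕ → Tree ℕ
  round g t = mapTree (λ ks → sum (map (value t) ks)) g

  walks : Graph → ℕ → Tree ℕ
  walks g zero    = node leaf startKey 1 leaf
  walks g (suc n) = round g (walks g n)

  value-round : ∀ g t k → value (round g t) k ≡ fromMaybe 0 (Maybe.map (λ ks → sum (map (value t) ks)) (lookup g k))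
  value-round g t k = cong (fromMaybe 0) (lookup-mapTree (λ ks → sum (map (value t) ks)) g k)

  Sound : ℕ → Tree ℕ → Set
  Sound d t = ∀ k → Completable (decode k) d (value t k)

  completable-final : Completable startState 0 1
  completable-final = record { fits = λ _ → ℕ.≤-refl ; total = λ _ _ 𝒫 → count-final 𝒫 }

  sound-start : ∀ {d} → Completable startState d 1 → Sound d (node leaf startKey 1 leaf)
  sound-start {d} C k with k <ᵇ startKey
  ... | true = completable-0
  ... | false with k ≡ᵇ startKey in k≡ᵇ
  ...   | false = completable-0
  ...   | true  = subst (λ k → Completable (decode k) d 1) (sym (ℕ.≡ᵇ⇒≡ k startKey (Equivalence.from Bool.T-≡ k≡ᵇ))) C

  sound-round : ∀ {g d t} → Faithful neighbours g → Sound d t → Sound (suc d) (round g t)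
  sound-round {g} {d} {t} F S k = subst (Completable (decode k) (suc d)) (sym (value-round g t k)) (go (lookup g k) F)
    where
    go : ∀ m → (∀ {ks} → m ≡ just ks → ks ≡ neighbours k) →
      Completable (decode k) (suc d) (fromMaybe 0 (Maybe.map (λ ks → sum (map (value t) ks)) m))
    go nothing   _  = completable-0
    go (just ks) F′ = subst (λ ks → Completable (decode k) (suc d) (sum (map (value t) ks))) (sym (F′ refl))
      (completable-step (value t) S (decode k))

  sound-walks : ∀ {g d} → Faithful neighbours g → Completable startState d 1 → ∀ n → Sound (n + d) (walks g n)
  sound-walks F C zero    = sound-start C
  sound-walks {g} F C (suc n) = sound-round {g} {t = walks g n} F (sound-walks F C n)

  scaled-sum : ∀ a b (f h : ℕ → ℕ) → (∀ k → a * f k ≤ b * h k) → ∀ ks → a * sum (map f ks) ≤ b * sum (map h ks)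
  scaled-sum a b f h le []       = ℕ.≤-reflexive (trans (ℕ.*-zeroʳ a) (sym (ℕ.*-zeroʳ b)))
  scaled-sum a b f h le (k ∷ ks) = subst₂ _≤_ (sym (ℕ.*-distribˡ-+ a (f k) _)) (sym (ℕ.*-distribˡ-+ b (h k) _))
    (ℕ.+-mono-≤ (le k) (scaled-sum a b f h le ks))

  -- The adjacency operator is linear and monotone: if it enlarges `w` at least by the factor
  -- `a / b` at every vertex, its `m`-th power does so by `(a / b) ^ m`. Denominators are cleared
  -- throughout.
  module Growth (a b : ℕ) (w : ℕ → ℕ) (step : ∀ k → a * w k ≤ b * sum (map w (neighbours k)))
    (d₀ : ℕ) (base : ∀ k → Completable (decode k) d₀ (w k)) where

    grows : ∀ m k → ∃ λ c → Completable (decode k) (m + d₀) c × a ^ m * w k ≤ b ^ m * c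
    grows zero    k = w k , base k , ℕ.≤-refl
    grows (suc m) k = sum (map c (neighbours k)) , completable-step c (λ k → proj₁ (proj₂ (grows m k))) (decode k) , (begin
      a * a ^ m * w k                                     ≡⟨ cong (_* w k) (ℕ.*-comm a (a ^ m)) ⟩
      a ^ m * a * w k                                     ≡⟨ ℕ.*-assoc (a ^ m) a (w k) ⟩
      a ^ m * (a * w k)                                   ≤⟨ ℕ.*-monoʳ-≤ (a ^ m) (step k) ⟩
      a ^ m * (b * sum (map w (neighbours k)))   ≡⟨ exchange (a ^ m) b _ ⟩
      b * (a ^ m * sum (map w (neighbours k)))   ≤⟨ ℕ.*-monoʳ-≤ b (scaled-sum (a ^ m) (b ^ m) w c
                                                       (λ k → proj₂ (proj₂ (grows m k))) (neighbours k)) ⟩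
      b * (b ^ m * sum (map c (neighbours k)))   ≡⟨ ℕ.*-assoc b (b ^ m) _ ⟨
      b * b ^ m * sum (map c (neighbours k))     ∎)
      where
      open ℕ.≤-Reasoning
      c : ℕ → ℕ
      c k = proj₁ (grows m k)
      exchange : ∀ x y z → x * (y * z) ≡ y * (x * z)
      exchange = solve-∀

  dominates : Graph → Tree ℕ → Bool
  dominates g t = (0 <ᵇ value t startKey) ∧ allNodes (λ k ks → 237 * value t k ≤ᵇ 100 * sum (map (value t) ks)) g

  -- There is one closed walk at the start of length 13 and one of length 14. The lengths being
  -- coprime, the start has a completion for all large `d`, which makes the numbers of walks of
  -- length 32 valid bounds.
  certified : Graph → Bool
  certified g = (value (walks g 13) startKey ≡ᵇ 1) ∧ (value (walks g 14) startKey ≡ᵇ 1)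
              ∧ dominates g (walks g 32)

  module _ (g : Graph) (F : Faithful neighbours g)
    (one₁₃ : value (walks g 13) startKey ≡ 1) (one₁₄ : value (walks g 14) startKey ≡ 1) where

    extend : ∀ {d} n → value (walks g n) startKey ≡ 1 → Completable startState d 1 → Completable startState (n + d) 1
    extend {d} n e C = subst (Completable startState (n + d)) e (sound-walks {g} F C n startKey)

    loops : ∀ x y → Completable startState (x * 13 + y * 14) 1
    loops zero    zero    = completable-final
    loops zero    (suc y) = extend 14 one₁₄ (loops zero y)
    loops (suc x) y       = subst (λ d → Completable startState d 1) (sym (ℕ.+-assoc 13 (x * 13) (y * 14)))
                              (extend 13 one₁₃ (loops x y))

    -- Every d ≥ 12 · 13 is a combination of 13 and 14.
    start-completable : ∀ m → Completable startState (m + 156) 1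
    start-completable m = subst (λ d → Completable startState d 1) combine (loops (u + m / 13) r)
      where
      r u : ℕ
      r = m % 13
      -- With `m = 13 q + r`, there are `12 + q` closed walks, of which `r` have length 14.
      u = 12 ∸ r
      ring : ∀ u q r → (u + q) * 13 + r * 14 ≡ (r + q * 13) + (u + r) * 13
      ring = solve-∀
      combine : (u + m / 13) * 13 + r * 14 ≡ m + 156
      combine = trans (ring u (m / 13) r) (cong₂ _+_ (sym (m≡m%n+[m/n]*n m 13))
        (cong (_* 13) {u + r} {12} (ℕ.m∸n+n≡m (ℕ.≤-pred (m%n<n m 13)))))

  module _ (H : ℕ → ℕ) (bounded : ∀ {d c} → Completable startState d c → c ≤ H (14 + d)) where

    growth-from : ∀ {g t d} → Faithful neighbours g → (∀ k → lookup g k ≡ nothing → value t k ≡ 0) →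
      Sound d t → T (dominates g t) → ∀ m → 237 ^ m ≤ 100 ^ m * H (m + (d + 14))
    growth-from {g} {t} {d} F absent S dom m = final (Growth.grows 237 100 w step d S m startKey)
      where
      w : ℕ → ℕ
      w = value t

      positive : 0 < w startKey
      positive = ℕ.<ᵇ⇒< 0 (w startKey) (proj₁ (Equivalence.to Bool.T-∧ dom))

      inequalities : T (allNodes (λ k ks → 237 * w k ≤ᵇ 100 * sum (map w ks)) g)
      inequalities = proj₂ (Equivalence.to (Bool.T-∧ {0 <ᵇ w startKey}) dom)

      step : ∀ k → 237 * w k ≤ 100 * sum (map w (neighbours k))
      step k = go (lookup g k) refl
        where
        go : ∀ m → lookup g k ≡ m → 237 * w k ≤ 100 * sum (map w (neighbours k))
        -- Off the graph `w` vanishes, so nothing has to be known about the successors.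
        go nothing   e = subst (λ z → 237 * z ≤ 100 * sum (map w (neighbours k))) (sym (absent k e)) z≤n
        go (just ks) e = subst (λ ks → 237 * w k ≤ 100 * sum (map w ks)) (F e)
          (ℕ.≤ᵇ⇒≤ _ _ (allNodes-lookup (λ k ks → 237 * w k ≤ᵇ 100 * sum (map w ks)) g inequalities e))

      final : (∃ λ c → Completable (decode startKey) (m + d) c × 237 ^ m * w startKey ≤ 100 ^ m * c) →
        237 ^ m ≤ 100 ^ m * H (m + (d + 14))
      final (c , C , le) = begin
        237 ^ m                     ≤⟨ ℕ.m≤m*n (237 ^ m) (w startKey) ⦃ >-nonZero positive ⦄ ⟩
        237 ^ m * w startKey        ≤⟨ le ⟩
        100 ^ m * c                 ≤⟨ ℕ.*-monoʳ-≤ (100 ^ m) (bounded C) ⟩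
        100 ^ m * H (14 + (m + d))  ≡⟨ cong (λ n → 100 ^ m * H n) (trans (ℕ.+-comm 14 (m + d)) (ℕ.+-assoc m d 14)) ⟩
        100 ^ m * H (m + (d + 14))  ∎
        where open ℕ.≤-Reasoning

    -- The start is completable with `d = 156`; the 32 steps of the walks lead to `d = 188`, and the
    -- start path accounts for 14 more labels, whence 202.
    growth : ∀ g → Faithful neighbours g → T (certified g) → ∀ m → 237 ^ m ≤ 100 ^ m * H (m + 202)
    growth g F ok = growth-from {g} {walks g 32} {188} F absent
      (sound-walks {g} F (start-completable g F (ℕ.≡ᵇ⇒≡ _ 1 (proj₁ ok₁)) (ℕ.≡ᵇ⇒≡ _ 1 (proj₁ ok₂)) 0) 32) (proj₂ ok₂)
      where
      ok₁ : T (value (walks g 13) startKey ≡ᵇ 1) × T ((value (walks g 14) startKey ≡ᵇ 1) ∧ dominates g (walks g 32))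
      ok₁ = Equivalence.to (Bool.T-∧ {value (walks g 13) startKey ≡ᵇ 1}) ok

      ok₂ : T (value (walks g 14) startKey ≡ᵇ 1) × T (dominates g (walks g 32))
      ok₂ = Equivalence.to (Bool.T-∧ {value (walks g 14) startKey ≡ᵇ 1}) (proj₂ ok₁)

      absent : ∀ k → lookup g k ≡ nothing → value (walks g 32) k ≡ 0
      absent k e = trans (value-round g (walks g 31) k)
        (cong (λ m → fromMaybe 0 (Maybe.map (λ ks → sum (map (value (walks g 31)) ks)) m)) e)

    explored-growth : ∀ fuel ks → certified (explore neighbours fuel ks leaf) ≡ true →
      ∀ m → 237 ^ m ≤ 100 ^ m * H (m + 202)
    explored-growth fuel ks ok = growth (explore neighbours fuel ks leaf) (explore-faithful neighbours fuel ks {leaf} λ ())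
      (Equivalence.from Bool.T-≡ ok)

open Walks

-- Passing to powers of a rational number.

module Rationals where
  open import Algebra.Bundles using (CommutativeRing)
  import Algebra.Properties.CommutativeSemiring.Exp as CommutativeSemiringExp
  import Algebra.Properties.Semiring.Exp as SemiringExp
  open import Data.Integer.Base as ℤ using (+_)
  import Data.Integer.Properties as ℤ
  open import Data.Nat.Base as ℕ using (ℕ; zero; suc)
  import Data.Nat.Properties as ℕ
  open import Data.Product.Base using (_×_; Σ-syntax; _,_)
  open import Data.Rational.Base using (ℚ; 0ℚ; 1ℚ; _/_; _*_; _<_; _≤_; _≥_; *≤*; positive)
  open import Data.Rational.Literals using (fromℤ)
  import Data.Rational.Properties as ℚ
  open import Relation.Binary.PropositionalEquality
    using (_≡_; refl; sym; trans; cong; cong₂; subst; subst₂)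

  private
    commutativeSemiring = CommutativeRing.commutativeSemiring ℚ.+-*-commutativeRing

  open CommutativeSemiringExp commutativeSemiring using (^-distrib-*)
  open SemiringExp (CommutativeRing.semiring ℚ.+-*-commutativeRing) using (^-homo-*)

  -- `_/ 1` divides by a gcd, which is stuck on a variable numerator, whereas this form has
  -- denominator 1 by definition.
  fromℕ : ℕ → ℚ
  fromℕ n = fromℤ (+ n)

  /1≡fromℕ : ∀ n → (+ n) / 1 ≡ fromℕ n
  /1≡fromℕ n = ℚ.↥p/↧p≡p (fromℕ n)

  fromℕ-* : ∀ a b → fromℕ a * fromℕ b ≡ fromℕ (a ℕ.* b)
  fromℕ-* a b = trans (cong (_/ 1) (sym (ℤ.pos-* a b))) (/1≡fromℕ (a ℕ.* b))

  fromℕ-^ : ∀ a n → fromℕ a ^ℚ n ≡ fromℕ (a ℕ.^ n)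
  fromℕ-^ a zero    = refl
  fromℕ-^ a (suc n) = trans (cong (fromℕ a *_) (fromℕ-^ a n)) (fromℕ-* a (a ℕ.^ n))

  fromℕ-≤ : ∀ {a b} → a ℕ.≤ b → fromℕ a ≤ fromℕ b
  fromℕ-≤ {a} {b} a≤b = *≤* (subst₂ ℤ._≤_ (sym (ℤ.*-identityʳ (+ a))) (sym (ℤ.*-identityʳ (+ b))) (ℤ.+≤+ a≤b))

  ^-positive : ∀ p n → 0ℚ < p → 0ℚ < p ^ℚ n
  ^-positive p zero    p>0 = ℚ.positive⁻¹ 1ℚ
  ^-positive p (suc n) p>0 = subst (_< p * p ^ℚ n) (ℚ.*-zeroʳ p) (ℚ.*-monoʳ-<-pos p ⦃ positive p>0 ⦄ (^-positive p n p>0))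

  1^ : ∀ n → 1ℚ ^ℚ n ≡ 1ℚ
  1^ zero    = refl
  1^ (suc n) = trans (ℚ.*-identityˡ _) (1^ n)

  λ₀ λ₀⁻¹ : ℚ
  λ₀   = (+ 237) / 100
  λ₀⁻¹ = (+ 100) / 237

  λ₀^≤ : ∀ {m b} → 237 ℕ.^ m ℕ.≤ 100 ℕ.^ m ℕ.* b → λ₀ ^ℚ m ≤ (+ b) / 1
  λ₀^≤ {m} {b} le = ℚ.*-cancelˡ-≤-pos (fromℕ 100 ^ℚ m)
    ⦃ positive (^-positive (fromℕ 100) m (ℚ.positive⁻¹ (fromℕ 100))) ⦄ (begin
    -- The product of `fromℕ 100` and `λ₀` evaluates to `fromℕ 237`.
    fromℕ 100 ^ℚ m * λ₀ ^ℚ m         ≡⟨ ^-distrib-* (fromℕ 100) λ₀ m ⟨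
    fromℕ 237 ^ℚ m                   ≡⟨ fromℕ-^ 237 m ⟩
    fromℕ (237 ℕ.^ m)                ≤⟨ fromℕ-≤ le ⟩
    fromℕ (100 ℕ.^ m ℕ.* b)          ≡⟨ fromℕ-* (100 ℕ.^ m) b ⟨
    fromℕ (100 ℕ.^ m) * fromℕ b      ≡⟨ cong₂ _*_ (fromℕ-^ 100 m) (/1≡fromℕ b) ⟨
    fromℕ 100 ^ℚ m * ((+ b) / 1)     ∎)
    where open ℚ.≤-Reasoning

  rational-growth : ∀ (H : ℕ → ℕ) N → (∀ m → 237 ℕ.^ m ℕ.≤ 100 ℕ.^ m ℕ.* H (m ℕ.+ N)) →
    Σ[ c ∈ ℚ ] (0ℚ < c × (Σ[ n₀ ∈ ℕ ] (∀ (n : ℕ) → n ℕ.≥ n₀ → (+ H n) / 1 ≥ c * (((+ 237) / 100) ^ℚ n))))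
  -- The constant `λ₀⁻¹ ^ℚ N` absorbs the shift of the argument of `H` by `N`.
  rational-growth H N bound = λ₀⁻¹ ^ℚ N , ^-positive λ₀⁻¹ N (ℚ.positive⁻¹ λ₀⁻¹) , N , λ n n≥N →
    subst (λ n → λ₀⁻¹ ^ℚ N * λ₀ ^ℚ n ≤ (+ H n) / 1) (ℕ.m∸n+n≡m n≥N) (at (n ℕ.∸ N))
    where
    at : ∀ m → λ₀⁻¹ ^ℚ N * λ₀ ^ℚ (m ℕ.+ N) ≤ (+ H (m ℕ.+ N)) / 1
    at m = begin
      λ₀⁻¹ ^ℚ N * λ₀ ^ℚ (m ℕ.+ N)
        ≡⟨ cong (λ₀⁻¹ ^ℚ N *_) (trans (cong (λ₀ ^ℚ_) (ℕ.+-comm m N)) (^-homo-* λ₀ N m)) ⟩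
      λ₀⁻¹ ^ℚ N * (λ₀ ^ℚ N * λ₀ ^ℚ m)      ≡⟨ ℚ.*-assoc (λ₀⁻¹ ^ℚ N) (λ₀ ^ℚ N) (λ₀ ^ℚ m) ⟨
      λ₀⁻¹ ^ℚ N * λ₀ ^ℚ N * λ₀ ^ℚ m        ≡⟨ cong (_* λ₀ ^ℚ m) (^-distrib-* λ₀⁻¹ λ₀ N) ⟨
      1ℚ ^ℚ N * λ₀ ^ℚ m                    ≡⟨ cong (_* λ₀ ^ℚ m) (1^ N) ⟩
      1ℚ * λ₀ ^ℚ m                         ≡⟨ ℚ.*-identityˡ (λ₀ ^ℚ m) ⟩
      λ₀ ^ℚ m                              ≤⟨ λ₀^≤ {m} (bound m) ⟩
      (+ H (m ℕ.+ N)) / 1                  ∎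
      where open ℚ.≤-Reasoning

open Rationals

-- Evaluation of the certificate, and the bound for `G`.

open import Data.Nat.Base using (ℕ) renaming (_≥_ to _≥ℕ_)
open import Data.Integer.Base using (+_)
open import Data.Rational.Base using (ℚ; 0ℚ; _/_; _*_; _<_; _≥_)
open import Data.Product.Base using (_×_; Σ-syntax)
open import Data.Bool.Base using (true)
open import Data.List.Base using ([]; _∷_)
open import Relation.Binary.PropositionalEquality using (_≡_; refl)

-- Exploring the 1177 vertices takes one step for the start and one for each of the 3118 edges.
certificate : certified (explore neighbours 3120 (startKey ∷ []) leaf) ≡ true
certificate = refl

theorem1 : Σ[ c ∈ ℚ ] (0ℚ < c × (Σ[ n₀ ∈ ℕ ] (∀ (n : ℕ) → n ≥ℕ n₀ → (+ G n) / 1 ≥ c * (((+ 237) / 100) ^ℚ n))))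
theorem1 = rational-growth G 202 (explored-growth G completable-start⇒≤G 3120 (startKey ∷ []) certificate)
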